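{- Let $n$ and $s$ be integers with $\gcd(s,n)=1$ and let $\mathcal C$ be an $\mathbb F_{q^n}$-subspace of $\mathcal L_{n,q}$ of dimension $k>2$. Let $V:=\mathcal C\cap\mathcal C^{[s]}$. Suppose $\dim V=k-2$ and $\mathcal C\cap\mathcal U_1=\{0\}$. Then: (1) if $\dim(V\cap V^{[s]})=k-3$, there exist $p(x),q(x)\in\mathcal C$ such that \[\mathcal C=\langle p(x),p(x)^{[s]},\ldots,p(x)^{[s(k-2)]}\rangle_{\mathbb F_{q^n}}\oplus\langle q(x)\rangle_{\mathbb F_{q^n}};\] (2) if $\dim(V\cap V^{[s]})=k-4$, there exist $p(x),q(x)\in\mathcal C$ and integers $i,j\ge2$ with $i+j=k$ such that \[\mathcal C=\langle p(x),p(x)^{[s]},\ldots,p(x)^{[s(i-1)]}\rangle_{\mathbb F_{q^n}}\oplus\langle q(x),q(x)^{[s]},\ldots,q(x)^{[s(j-1)]}\rangle_{\mathbb F_{q^n}}.\]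
   Context: $q$ is a prime power, $[i]:=q^i$. $\mathcal L_{n,q}$ is the $\mathbb F_{q^n}$-vector space of linearized polynomials $f(x)=\sum_{i=0}^{n-1}a_ix^{[i]}$, $a_i\in\mathbb F_{q^n}$, identified with $\mathbb F_q$-linear maps of $\mathbb F_{q^n}$ (rank = dimension of the image over $\mathbb F_q$). For $f(x)=\sum_i a_ix^{[i]}$, $f(x)^{[j]}:=x^{[j]}\circ f(x)=\sum_i a_i^{[j]}x^{[(i+j)\bmod n]}$, and for a subset $W$, $W^{[j]}=\{f^{[j]}\colon f\in W\}$. $\mathcal U_1$ is the set of elements of $\mathcal L_{n,q}$ of rank at most one. -}

module Defs where

open import Algebra.Apartness.Bundles using (HeytingField; HeytingCommutativeRing)
open import Algebra.Bundles using (Ring; CommutativeRing)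
open import Algebra.Module.Bundles using (LeftModule)
import Algebra.Definitions.RawMonoid as RawMonoidDefs
import Algebra.Module.Construct.TensorUnit as TensorUnit
import Algebra.Properties.Semiring.Exp as Exp
open import Data.Fin.Base using (Fin; toℕ; fromℕ<)
open import Data.Integer.Base as ℤ using (ℤ; +_; _%ℕ_)
open import Data.Integer.DivMod using (n%ℕd<d)
open import Data.Nat.Base as ℕ using (ℕ; NonZero)
open import Data.Nat.Primality using (Prime)
open import Data.Product.Base using (_×_; _,_; ∃-syntax)
open import Data.Vec.Functional using (Vector)
open import Function.Bundles using (Inverse)
open import Level using (Level; _⊔_)
open import Relation.Binary.PropositionalEquality using (_≡_)
import Relation.Binary.PropositionalEquality as ≡
open import Relation.Unary using (Pred; _∈_; _∩_; _≐_; U)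

IsPrimePower : ℕ → Set
IsPrimePower q = ∃[ p ] ∃[ e ] (Prime p × 1 ℕ.≤ e × q ≡ p ℕ.^ e)

-- The scalars are restricted to a subset S of the ring (a subfield in the
-- uses below), so that dimensions over a subfield need no separate bundle.
module LinearAlgebra
  {r ℓr m ℓm s} {R : Ring r ℓr} (M : LeftModule R m ℓm)
  (S : Pred (Ring.Carrier R) s)
  where

  open Ring R using (Carrier; _≈_; 0#)
  open LeftModule M
  open RawMonoidDefs +ᴹ-rawMonoid using (sum)

  private
    variable
      a b w : Level
      d : ℕ

  combination : Vector Carrier d → Vector Carrierᴹ d → Carrierᴹ
  combination c v = sum (λ i → c i *ₗ v i)

  ⟨_⟩ : Vector Carrierᴹ d → Pred Carrierᴹ (r ⊔ s ⊔ ℓm)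
  ⟨ v ⟩ x = ∃[ c ] ((∀ i → c i ∈ S) × x ≈ᴹ combination c v)

  LinearlyIndependent : Vector Carrierᴹ d → Set (r ⊔ ℓr ⊔ s ⊔ ℓm)
  LinearlyIndependent v =
    ∀ c → (∀ i → c i ∈ S) → combination c v ≈ᴹ 0ᴹ → ∀ i → c i ≈ 0#

  HasDimension : Pred Carrierᴹ w → ℕ → Set (r ⊔ ℓr ⊔ s ⊔ m ⊔ ℓm ⊔ w)
  HasDimension W d =
    ∃[ v ] (LinearlyIndependent {d} v × W ≐ ⟨ v ⟩)

  record IsSubspace (W : Pred Carrierᴹ w) : Set (r ⊔ s ⊔ m ⊔ ℓm ⊔ w) where
    field
      resp-≈ᴹ   : ∀ {x y} → x ≈ᴹ y → x ∈ W → y ∈ W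
      0ᴹ-closed : 0ᴹ ∈ W
      +ᴹ-closed : ∀ {x y} → x ∈ W → y ∈ W → (x +ᴹ y) ∈ W
      *ₗ-closed : ∀ {c x} → c ∈ S → x ∈ W → (c *ₗ x) ∈ W

  zeroSubspace : Pred Carrierᴹ ℓm
  zeroSubspace x = x ≈ᴹ 0ᴹ

  infixl 6 _∔_
  infix 4 _≐_⊕_

  _∔_ : Pred Carrierᴹ a → Pred Carrierᴹ b → Pred Carrierᴹ (m ⊔ ℓm ⊔ a ⊔ b)
  (A ∔ B) x = ∃[ y ] ∃[ z ] (y ∈ A × z ∈ B × x ≈ᴹ y +ᴹ z)

  _≐_⊕_ : Pred Carrierᴹ w → Pred Carrierᴹ a → Pred Carrierᴹ b →
          Set (m ⊔ ℓm ⊔ w ⊔ a ⊔ b)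
  W ≐ A ⊕ B = W ≐ (A ∔ B) × (A ∩ B) ≐ zeroSubspace

-- A Heyting field in bijection with Fin N is a finite field of order N in
-- the usual sense: equality is decidable, so apartness is just inequality.
HasOrder : ∀ {c ℓ₁ ℓ₂} → HeytingField c ℓ₁ ℓ₂ → ℕ → Set (c ⊔ ℓ₁)
HasOrder F N =
  Inverse (CommutativeRing.setoid commutativeRing) (≡.setoid (Fin N))
  where
  open HeytingField F using (heytingCommutativeRing)
  open HeytingCommutativeRing heytingCommutativeRing using (commutativeRing)

-- F plays the role of the field with q ^ n elements.
module LinearizedPolynomials
  {c ℓ₁ ℓ₂} (F : HeytingField c ℓ₁ ℓ₂) (q n : ℕ) .{{_ : NonZero n}}
  where

  open HeytingField F using (heytingCommutativeRing)
  open HeytingCommutativeRing heytingCommutativeRing using (commutativeRing)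
  open CommutativeRing commutativeRing
  open Exp semiring using (_^_)
  open RawMonoidDefs +-rawMonoid using (sum)

  -- Coefficient vectors: f i is the coefficient of x ^ (q ^ i), 0 ≤ i < n.
  𝓛 : Set c
  𝓛 = Vector Carrier n

  𝓛-leftModule : LeftModule ring c ℓ₁
  𝓛-leftModule = record
    { Carrierᴹ = 𝓛
    ; _≈ᴹ_ = λ f g → ∀ i → f i ≈ g i
    ; _+ᴹ_ = λ f g i → f i + g i
    ; _*ₗ_ = λ a f i → a * f i
    ; 0ᴹ = λ _ → 0#
    ; -ᴹ_ = λ f i → - f i
    ; isLeftModule = record
      { isLeftSemimodule = record
        { +ᴹ-isCommutativeMonoid = record
          { isMonoid = record
            { isSemigroup = record
              { isMagma = record
                { isEquivalence = record
                  { refl = λ _ → refl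
                  ; sym = λ e i → sym (e i)
                  ; trans = λ e e′ i → trans (e i) (e′ i)
                  }
                ; ∙-cong = λ e e′ i → +-cong (e i) (e′ i)
                }
              ; assoc = λ f g h i → +-assoc (f i) (g i) (h i)
              }
            ; identity = (λ f i → +-identityˡ (f i)) , (λ f i → +-identityʳ (f i))
            }
          ; comm = λ f g i → +-comm (f i) (g i)
          }
        ; isPreleftSemimodule = record
          { *ₗ-cong = λ e e′ i → *-cong e (e′ i)
          ; *ₗ-zeroˡ = λ f i → zeroˡ (f i)
          ; *ₗ-distribʳ = λ f a b i → distribʳ (f i) a b
          ; *ₗ-identityˡ = λ f i → *-identityˡ (f i)
          ; *ₗ-assoc = λ a b f i → *-assoc a b (f i)
          ; *ₗ-zeroʳ = λ a i → zeroʳ a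
          ; *ₗ-distribˡ = λ a f g i → distribˡ a (f i) (g i)
          }
        }
      ; -ᴹ‿cong = λ e i → -‿cong (e i)
      ; -ᴹ‿inverse = (λ f i → -‿inverseˡ (f i)) , (λ f i → -‿inverseʳ (f i))
      }
    }

  open LeftModule 𝓛-leftModule public using (_≈ᴹ_)
  open LinearAlgebra 𝓛-leftModule U public

  -- The roots of x ^ q - x in F: the subfield of order q.
  𝔽q : Pred Carrier ℓ₁
  𝔽q x = x ^ q ≈ x

  eval : 𝓛 → Carrier → Carrier
  eval f x = sum (λ i → f i * x ^ (q ℕ.^ toℕ i))

  image : 𝓛 → Pred Carrier (c ⊔ ℓ₁)
  image f y = ∃[ x ] y ≈ eval f x

  HasRank : 𝓛 → ℕ → Set (c ⊔ ℓ₁)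
  HasRank f r = Over𝔽q.HasDimension (image f) r
    where module Over𝔽q = LinearAlgebra (TensorUnit.leftModule {R = ring}) 𝔽q

  𝓤₁ : Pred 𝓛 (c ⊔ ℓ₁)
  𝓤₁ f = ∃[ r ] (r ℕ.≤ 1 × HasRank f r)

  -- x ↦ x ^ (q ^ j).  Its n-th iterate is the identity on F, so reducing j
  -- modulo n changes nothing for j ≥ 0 and also gives a meaning to j < 0.
  frobenius : ℤ → Carrier → Carrier
  frobenius j x = x ^ (q ℕ.^ (j %ℕ n))

  infixl 9 _^[_] _^⟦_⟧

  -- The coefficient a i of f contributes frobenius j (a i) in position
  -- (i + j) mod n; equivalently, position m receives it from (m - j) mod n.
  _^[_] : 𝓛 → ℤ → 𝓛
  (f ^[ j ]) m = frobenius j (f (fromℕ< (n%ℕd<d (+ toℕ m ℤ.- j) n)))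

  _^⟦_⟧ : ∀ {w} → Pred 𝓛 w → ℤ → Pred 𝓛 (c ⊔ ℓ₁ ⊔ w)
  (W ^⟦ j ⟧) g = ∃[ f ] (f ∈ W × g ≈ᴹ f ^[ j ])

  -- f, f^[s], …, f^[s(m-1)]
  orbit : ℤ → 𝓛 → (m : ℕ) → Vector 𝓛 m
  orbit s f m i = f ^[ s ℤ.* + toℕ i ]

{-# OPTIONS --safe #-}

-- Let σ be f ↦ f^[s].  A nonzero subspace W ⊆ C with W ⊆ σ W would contain
-- every conjugate of some f ≠ 0, hence, since gcd(s,n) = 1, a nonzero sum
-- Σ_i c^[i] f^[i] = Σ_i b^[i] x^[i], which has rank one; so C has no such
-- subspace.  Put core W = W ∩ σ W.  The dimension drops along C, core C,
-- core (core C), … do not increase and stay positive until 0 is reached.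
-- If core W is a direct sum of at most two chains x, σ x, σ² x, …, then
-- starting each of these chains one step earlier, at σ⁻¹ x ∈ W, and adding a
-- complementary vector if the drop has just increased, decomposes W.
module Submission where

open import Defs
open import Algebra.Apartness.Bundles using (HeytingField; HeytingCommutativeRing)
open import Algebra.Bundles using (CommutativeMonoid; CommutativeRing)
open import Algebra.Module.Bundles using (LeftModule)
import Algebra.Module.Properties.LeftModule as LeftModuleProperties
import Algebra.Properties.AbelianGroup as AbelianGroupProperties
import Algebra.Properties.CommutativeMonoid.Sum as Sum
import Algebra.Properties.CommutativeSemiring.Binomial as Binomial
import Algebra.Properties.CommutativeSemiring.Exp as Exp
import Algebra.Properties.Ring as RingProperties
import Algebra.Properties.Semiring.Mult as Mult
import Algebra.Properties.Semiring.Sum as SemiringSum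
import Algebra.Solver.Ring.NaturalCoefficients.Default as NaturalCoefficients
open import Data.Empty using (⊥)
open import Data.Fin.Base
  using (Fin; zero; suc; toℕ; fromℕ; fromℕ<; inject₁; inject≤; combine; funToFin; finToFun; splitAt; _↑ˡ_; _↑ʳ_)
open import Data.Fin.Permutation using (Permutation′; permutation)
import Data.Fin.Properties as Fin
open import Data.Integer.Base as ℤ using (ℤ; +_; -[1+_]; _%ℕ_; ∣_∣)
open import Data.Integer.DivMod using (n%ℕd<d; a≡a%ℕn+[a/ℕn]*n)
open import Data.Integer.GCD using (gcd)
import Data.Integer.Properties as ℤ
open import Data.Integer.Tactic.RingSolver using (solve-∀)
open import Data.Nat.Base as ℕ using (ℕ; zero; suc; z≤n; s≤s; _!; NonZero)
open import Data.Nat.Combinatorics using (nCn≡1; nCk≡n!/k![n-k]!; k![n∸k]!∣n!) renaming (_C_ to _choose_)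
open import Data.Nat.Divisibility using (_∣_; divides; ∣⇒≤; m∣m*n)
open import Data.Nat.DivMod using (_%_; _/_; [m+kn]%n≡m%n; m<n⇒m%n≡m; m≡m%n+[m/n]*n; m/n*n≡m)
open import Data.Nat.GCD using (module Bézout; gcd-GCD)
open import Data.Nat.Primality using (Prime; euclidsLemma; prime⇒nonZero; prime⇒nonTrivial)
import Data.Nat.Properties as ℕ
open import Data.Nat.Properties using (_!*_!≢0)
open import Data.Product.Base using (∃; ∃₂; ∃-syntax; _×_; _,_; proj₁; proj₂)
open import Data.Sum.Base using (_⊎_; inj₁; inj₂; [_,_]′)
open import Data.Unit.Base using (tt)
open import Data.Vec.Base using (Vec)
open import Data.Vec.Functional using (Vector; tail)
open import Function.Base using (_∘_; id)
open import Function.Bundles using (Inverse)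
open import Level using (Level; _⊔_)
import Relation.Binary.Definitions as B
open import Relation.Binary.Definitions using (_Respects_; tri<; tri≈; tri>)
import Relation.Binary.PropositionalEquality as ≡
open ≡ using (_≡_; _≢_; _≗_)
open import Relation.Nullary.Decidable using (Dec; yes; no; map′; _×-dec_; ¬?; decidable-stable)
open import Relation.Nullary.Negation using (¬_; contradiction)
open import Relation.Unary using (Pred; Decidable; U; _∈_; _∉_; _⊆_; _≐_; _∩_)

-- Some `c` makes the sum of conjugates nonzero because `b` is a combination of the powers `c^[i]`,
-- weighted by conjugates of the coefficients of `f`, and the maps `c ↦ c^[i]` are distinct
-- multiplicative characters, hence independent. The delicate point is that the new starting vectors
-- are independent modulo `core W`. Two of them are: σ turns a relation between them into a relation
-- between the old starts modulo `core (core W)`, which a drop of at least two rules out. A single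
-- one is: otherwise σ⁻¹ would map `core W` into itself. As the first drop is two, the drops read 2,
-- ..., 2, 1, ..., 1, so a complementary vector is added at most once and no third chain arises. The
-- two cases of the theorem differ in whether the second drop is one or two. Subspaces are bare
-- predicates. Finiteness of `F` makes them decidable by searching through coefficient vectors,
-- which is how bases of the cores and complementary vectors are found.

private
  variable
    a b w : Level
    d e m n : ℕ

-- Finite fields

funToFin-cong : {f g : Fin m → Fin n} → f ≗ g → funToFin f ≡ funToFin g
funToFin-cong {zero}  f≗g = ≡.refl
funToFin-cong {suc m} f≗g = ≡.cong₂ combine (f≗g zero) (funToFin-cong (f≗g ∘ suc))

module FiniteField
  {c ℓ₁ ℓ₂} (F : HeytingField c ℓ₁ ℓ₂) {N : ℕ} (finite : HasOrder F N)
  where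

  open HeytingField F using (heytingCommutativeRing; _#_; tight; #⇒invertible; invertible⇒#)
  open HeytingCommutativeRing heytingCommutativeRing using (commutativeRing)
  open CommutativeRing commutativeRing
  open RingProperties ring using (-0#≈0#)
  open import Relation.Binary.Reasoning.Setoid setoid
  open Inverse finite public using (to; from; to-cong; from-cong; strictlyInverseˡ; strictlyInverseʳ)

  _≟_ : B.Decidable _≈_
  x ≟ y = map′
    (λ e → trans (sym (strictlyInverseʳ x)) (trans (from-cong e) (strictlyInverseʳ y)))
    to-cong (to x Fin.≟ to y)

  any? : {P : Pred Carrier w} → P Respects _≈_ → Decidable P → Dec (∃ P)
  any? resp P? = map′
    (λ (i , Pi) → from i , Pi) (λ (x , Px) → to x , resp (sym (strictlyInverseʳ x)) Px)
    (Fin.any? (P? ∘ from))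

  -- `decode` and `encode` number the coefficient vectors. The numbering serves both the exhaustive
  -- search in `anyᵛ?` and the counting argument in `independent⇒≤`.
  decode : Fin (N ℕ.^ d) → Vector Carrier d
  decode k = from ∘ finToFun k

  encode : Vector Carrier d → Fin (N ℕ.^ d)
  encode v = funToFin (to ∘ v)

  decode-encode : (v : Vector Carrier d) → ∀ i → decode (encode v) i ≈ v i
  decode-encode v i =
    trans (from-cong (Fin.finToFun-funToFin (to ∘ v) i)) (strictlyInverseʳ (v i))

  encode-decode : (k : Fin (N ℕ.^ d)) → encode (decode {d} k) ≡ k
  encode-decode {d} k =
    ≡.trans (funToFin-cong (λ i → strictlyInverseˡ (finToFun {N} {d} k i))) (Fin.funToFin-finToFin {d} {N} k)

  encode-cong : {u v : Vector Carrier d} → (∀ i → u i ≈ v i) → encode u ≡ encode v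
  encode-cong u≈v = funToFin-cong (to-cong ∘ u≈v)

  anyᵛ? : {P : Pred (Vector Carrier d) w} → P Respects (λ u v → ∀ i → u i ≈ v i) →
          Decidable P → Dec (∃ P)
  anyᵛ? {d} resp P? = map′
    (λ (k , Pk) → decode k , Pk)
    (λ (v , Pv) → encode v , resp (λ i → sym (decode-encode v i)) Pv)
    (Fin.any? {N ℕ.^ d} (P? ∘ decode))

  -- A Heyting field only inverts elements apart from 0#; over a finite field
  -- an exhaustive search for the inverse upgrades this to x ≉ 0#.
  inverse : ∀ {x} → ¬ x ≈ 0# → ∃ λ y → y * x ≈ 1#
  inverse {x} x≉0 with any? (λ e y*x≈1 → trans (*-congʳ (sym e)) y*x≈1) (λ y → (y * x) ≟ 1#)
  ... | yes found = found
  ... | no none = contradiction (proj₁ (tight x 0#) ¬x#0) x≉0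
    where
    ¬x#0 : ¬ x # 0#
    ¬x#0 x#0 with y , y*[x-0]≈1 , _ ← #⇒invertible x#0 =
      none (y , trans (*-congˡ (sym x-0≈x)) y*[x-0]≈1)
      where
      x-0≈x : x - 0# ≈ x
      x-0≈x = trans (+-congˡ -0#≈0#) (+-identityʳ x)

  -- `1# - 0#` has the inverse `1#`, so `1#` and `0#` are apart; `tight` excludes this for equal
  -- elements.
  1≉0 : ¬ 1# ≈ 0#
  1≉0 1≈0 = proj₂ (tight 1# 0#) 1≈0
    (invertible⇒# (1# , trans (*-identityˡ _) 1-0≈1 , trans (*-identityʳ _) 1-0≈1))
    where
    1-0≈1 : 1# - 0# ≈ 1#
    1-0≈1 = trans (+-congˡ -0#≈0#) (+-identityʳ 1#)

  x*y≈0⇒y≈0 : ∀ {x y} → ¬ x ≈ 0# → x * y ≈ 0# → y ≈ 0#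
  x*y≈0⇒y≈0 {x} {y} x≉0 xy≈0 with z , zx≈1 ← inverse x≉0 = begin
    y           ≈⟨ *-identityˡ y ⟨
    1# * y      ≈⟨ *-congʳ zx≈1 ⟨
    z * x * y   ≈⟨ *-assoc z x y ⟩
    z * (x * y) ≈⟨ *-congˡ xy≈0 ⟩
    z * 0#      ≈⟨ zeroʳ z ⟩
    0#          ∎

  1<N : 1 ℕ.< N
  1<N = order>1 (to 0#) (to 1#) λ e →
    1≉0 (trans (sym (strictlyInverseʳ 1#)) (trans (from-cong (≡.sym e)) (strictlyInverseʳ 0#)))
    where
    order>1 : ∀ {n} (i j : Fin n) → ¬ i ≡ j → 1 ℕ.< n
    order>1 {1}           zero zero i≢j = contradiction ≡.refl i≢j
    order>1 {suc (suc _)} _    _    _   = ℕ.s≤s (ℕ.s≤s ℕ.z≤n)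

-- Prime divisors of factorials and binomial coefficients

prime∣m!⇒≤ : ∀ {p} → Prime p → ∀ m → p ∣ m ! → p ℕ.≤ m
prime∣m!⇒≤ p-prime zero    p∣1 = contradiction (∣⇒≤ p∣1) (ℕ.<⇒≱ (ℕ.nonTrivial⇒n>1 _))
  where instance _ = prime⇒nonTrivial p-prime
prime∣m!⇒≤ p-prime (suc m) p∣ with euclidsLemma (suc m) (m !) p-prime p∣
... | inj₁ p∣1+m = ∣⇒≤ p∣1+m
... | inj₂ p∣m!  = ℕ.m≤n⇒m≤1+n (prime∣m!⇒≤ p-prime m p∣m!)

-- p divides `p !`, the product of `p choose k` with the factorials of k and p - k, and both
-- factorials have only factors smaller than p.
prime∣pCk : ∀ {p k} → Prime p → 1 ℕ.≤ k → k ℕ.< p → p ∣ p choose k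
prime∣pCk {p@(suc p-1)} {k} p-prime 1≤k k<p =
  [ id , (λ p∣k!* → contradiction (euclidsLemma (k !) ((p ℕ.∸ k) !) p-prime p∣k!*) [ p∤k! , p∤[p-k]! ]′) ]′
    (euclidsLemma (p choose k) (k ! ℕ.* (p ℕ.∸ k) !) p-prime p∣C*)
  where
  instance
    _ = k !* (p ℕ.∸ k) !≢0

  p∣C* : p ∣ (p choose k) ℕ.* (k ! ℕ.* (p ℕ.∸ k) !)
  p∣C* = ≡.subst (p ∣_)
    (≡.sym (≡.trans (≡.cong (ℕ._* (k ! ℕ.* (p ℕ.∸ k) !)) (nCk≡n!/k![n-k]! (ℕ.<⇒≤ k<p)))
      (m/n*n≡m (k![n∸k]!∣n! (ℕ.<⇒≤ k<p)))))
    (m∣m*n (p-1 !))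

  p∤k! : ¬ p ∣ k !
  p∤k! p∣k! = ℕ.<⇒≱ k<p (prime∣m!⇒≤ p-prime k p∣k!)

  p∤[p-k]! : ¬ p ∣ (p ℕ.∸ k) !
  p∤[p-k]! p∣[p-k]! = ℕ.<⇒≱ (ℕ.∸-monoʳ-< 1≤k (ℕ.<⇒≤ k<p)) (prime∣m!⇒≤ p-prime (p ℕ.∸ k) p∣[p-k]!)

module _ {c ℓ} (M : CommutativeMonoid c ℓ) where
  open CommutativeMonoid M
  open Sum M

  -- Stated for any commutative monoid because its use is multiplicative: in `x^N≈x` it evaluates a
  -- product all of whose factors but one are 1.
  sum-single : (t : Vector Carrier n) (i : Fin n) → (∀ j → i ≢ j → t j ≈ ε) → sum t ≈ t i
  sum-single {n = suc n} t i t≈0 = trans (sum-remove {i = i} t)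
    (trans (∙-congˡ (trans (sum-cong-≋ (λ j → t≈0 _ (Fin.punchInᵢ≢i i j ∘ ≡.sym))) (sum-replicate-zero n)))
      (identityʳ (t i)))

-- Fermat's identity and additivity of powers of the characteristic

module FiniteFieldArithmetic
  {c ℓ₁ ℓ₂} (F : HeytingField c ℓ₁ ℓ₂) {N : ℕ} (finite : HasOrder F N)
  where

  open HeytingCommutativeRing (HeytingField.heytingCommutativeRing F) using (commutativeRing)
  open CommutativeRing commutativeRing hiding (zero)
  open FiniteField F finite
  open Exp commutativeSemiring
  open Mult semiring using (×1-homo-*; ×-assoc-*; ×-congʳ; ×-congˡ) renaming (_×_ to _·_)
  open SemiringSum semiring
  open Sum *-commutativeMonoid using () renaming
    (sum to product; sum-permute to product-permute; ∑-distrib-+ to product-distrib-*;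
     sum-cong-≋ to product-cong; sum-replicate to product-replicate)
  open AbelianGroupProperties +-abelianGroup using (∙-cancelˡ)
  open import Relation.Binary.Reasoning.Setoid setoid

  *-cancelˡ : ∀ {x y z} → ¬ x ≈ 0# → x * y ≈ x * z → y ≈ z
  *-cancelˡ {x} {y} {z} x≉0 xy≈xz with x⁻¹ , x⁻¹x≈1 ← inverse x≉0 = begin
    y             ≈⟨ undo y ⟨
    x⁻¹ * (x * y) ≈⟨ *-congˡ xy≈xz ⟩
    x⁻¹ * (x * z) ≈⟨ undo z ⟩
    z             ∎
    where
    undo : ∀ w → x⁻¹ * (x * w) ≈ w
    undo w = trans (sym (*-assoc x⁻¹ x w)) (trans (*-congʳ x⁻¹x≈1) (*-identityˡ w))

  x*y≉0 : ∀ {x y} → ¬ x ≈ 0# → ¬ y ≈ 0# → ¬ x * y ≈ 0#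
  x*y≉0 x≉0 y≉0 = y≉0 ∘ x*y≈0⇒y≈0 x≉0

  x^m≉0 : ∀ {x} → ¬ x ≈ 0# → ∀ m → ¬ x ^ m ≈ 0#
  x^m≉0 x≉0 zero    = 1≉0
  x^m≉0 x≉0 (suc m) = x*y≉0 x≉0 (x^m≉0 x≉0 m)

  product≉0 : (t : Vector Carrier n) → (∀ i → ¬ t i ≈ 0#) → ¬ product t ≈ 0#
  product≉0 {zero}  t t≉0 = 1≉0
  product≉0 {suc n} t t≉0 = x*y≉0 (t≉0 zero) (product≉0 (tail t) (t≉0 ∘ suc))

  private
    bijection : (f g : Carrier → Carrier) → (∀ {x y} → x ≈ y → f x ≈ f y) → (∀ {x y} → x ≈ y → g x ≈ g y) →
      (∀ x → f (g x) ≈ x) → (∀ x → g (f x) ≈ x) → Permutation′ N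
    bijection f g f-cong g-cong fg gf = permutation (to ∘ f ∘ from) (to ∘ g ∘ from)
      (λ i → ≡.trans (to-cong (trans (f-cong (strictlyInverseʳ _)) (fg (from i)))) (strictlyInverseˡ i))
      (λ i → ≡.trans (to-cong (trans (g-cong (strictlyInverseʳ _)) (gf (from i)))) (strictlyInverseˡ i))

  -- Adding `1#` permutes the field, so the sum of all elements is unchanged although each of its N
  -- terms has grown by `1#`.
  N×1≈0 : N · 1# ≈ 0#
  N×1≈0 = ∙-cancelˡ (sum from) _ _ (begin
    sum from + N · 1#                      ≈⟨ +-congˡ (sum-replicate N) ⟨
    sum from + sum {N} (λ _ → 1#)          ≈⟨ ∑-distrib-+ from (λ _ → 1#) ⟨
    sum (λ i → from i + 1#)                ≈⟨ sum-cong-≋ (λ i → strictlyInverseʳ (from i + 1#)) ⟨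
    sum (λ i → from (to (from i + 1#)))    ≈⟨ sum-permute from +1 ⟨
    sum from                               ≈⟨ +-identityʳ _ ⟨
    sum from + 0#                          ∎)
    where
    +1 : Permutation′ N
    +1 = bijection (_+ 1#) (_- 1#) +-congʳ +-congʳ
      (λ x → trans (+-assoc x (- 1#) 1#) (trans (+-congˡ (-‿inverseˡ 1#)) (+-identityʳ x)))
      (λ x → trans (+-assoc x 1# (- 1#)) (trans (+-congˡ (-‿inverseʳ 1#)) (+-identityʳ x)))

  -- Treating 0# separately lets the products below range over all of Fin N.
  private
    at-0 : Carrier → Carrier → Carrier → Carrier
    at-0 u v x with x ≟ 0#
    ... | yes _ = u
    ... | no  _ = v

  -- Multiplication by a nonzero `a` permutes the nonzero elements. Comparing their product before
  -- and after shows that `a` to the power N - 1 is one.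
  x^N≈x : ∀ x → x ^ N ≈ x
  x^N≈x a with a ≟ 0#
  ... | yes a≈0 = trans (zero-power N (ℕ.<⇒≤ 1<N)) (sym a≈0)
    where
    zero-power : ∀ m → 1 ℕ.≤ m → a ^ m ≈ 0#
    zero-power (suc m) _ = trans (*-congʳ a≈0) (zeroˡ (a ^ m))
  ... | no a≉0 = begin
    a ^ N                              ≈⟨ product-replicate N ⟨
    product {N} (λ _ → a)              ≈⟨ product-cong a≈hδ ⟩
    product (λ i → h i * δ i)          ≈⟨ product-distrib-* h δ ⟩
    product h * product δ              ≈⟨ *-congʳ product-h ⟩
    1# * product δ                     ≈⟨ *-identityˡ _ ⟩
    product δ                          ≈⟨ sum-single *-commutativeMonoid δ (to 0#) δ≈1 ⟩
    δ (to 0#)                          ≈⟨ δ₀ ⟩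
    a                                  ∎
    where
    -- `h` has the factor `a` at the N - 1 nonzero elements, `δ` the one remaining factor `a` at
    -- `0#`, and `g` lists the nonzero elements with `1#` standing in for `0#`.
    h δ g : Fin N → Carrier
    h i = at-0 1# a (from i)
    δ i = at-0 a 1# (from i)
    g i = at-0 1# (from i) (from i)

    a⁻¹ = proj₁ (inverse a≉0)
    a⁻¹a≈1 = proj₂ (inverse a≉0)

    *a : Permutation′ N
    *a = bijection (a *_) (a⁻¹ *_) *-congˡ *-congˡ
      (λ x → trans (sym (*-assoc a a⁻¹ x)) (trans (*-congʳ (trans (*-comm a a⁻¹) a⁻¹a≈1)) (*-identityˡ x)))
      (λ x → trans (sym (*-assoc a⁻¹ a x)) (trans (*-congʳ a⁻¹a≈1) (*-identityˡ x)))

    a≈hδ : ∀ i → a ≈ h i * δ i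
    a≈hδ i with from i ≟ 0#
    ... | yes _ = sym (*-identityˡ a)
    ... | no  _ = sym (*-identityʳ a)

    δ≈1 : ∀ j → to 0# ≢ j → δ j ≈ 1#
    δ≈1 j 0≢j with from j ≟ 0#
    ... | yes j≈0 = contradiction (≡.trans (to-cong (sym j≈0)) (strictlyInverseˡ j)) 0≢j
    ... | no  _   = refl

    δ₀ : δ (to 0#) ≈ a
    δ₀ with from (to 0#) ≟ 0#
    ... | yes _  = refl
    ... | no ≉0 = contradiction (strictlyInverseʳ 0#) ≉0

    g≉0 : ∀ i → ¬ g i ≈ 0#
    g≉0 i with from i ≟ 0#
    ... | yes _ = 1≉0
    ... | no i≉0 = i≉0

    g-shift : ∀ i → g (to (a * from i)) ≈ g i * h i
    g-shift i with from i ≟ 0# | from (to (a * from i)) ≟ 0#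
    ... | yes _   | yes _   = sym (*-identityˡ 1#)
    ... | yes i≈0 | no ai≉0 = contradiction (trans (strictlyInverseʳ _) (trans (*-congˡ i≈0) (zeroʳ a))) ai≉0
    ... | no i≉0  | yes ai≈0 = contradiction (trans (sym (strictlyInverseʳ _)) ai≈0) (x*y≉0 a≉0 i≉0)
    ... | no _    | no _    = trans (strictlyInverseʳ _) (*-comm a (from i))

    product-h : product h ≈ 1#
    product-h = *-cancelˡ (product≉0 g g≉0) (begin
      product g * product h                  ≈⟨ product-distrib-* g h ⟨
      product (λ i → g i * h i)              ≈⟨ product-cong g-shift ⟨
      product (λ i → g (to (a * from i)))    ≈⟨ product-permute g *a ⟨
      product g                              ≈⟨ *-identityʳ _ ⟨
      product g * 1#                         ∎)

  module Characteristic {p} (p-prime : Prime p) {k} (N≡p^k : N ≡ p ℕ.^ k) where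

    p^m×1 : ∀ m → (p ℕ.^ m) · 1# ≈ (p · 1#) ^ m
    p^m×1 zero    = +-identityʳ 1#
    p^m×1 (suc m) = trans (×1-homo-* p (p ℕ.^ m)) (*-congˡ (p^m×1 m))

    -- The k-th power of `p · 1#` is `N · 1#`, which vanishes, and powers of nonzero elements do not
    -- vanish.
    p×1≈0 : p · 1# ≈ 0#
    p×1≈0 with (p · 1#) ≟ 0#
    ... | yes ≈0 = ≈0
    ... | no ≉0 = contradiction
          (trans (sym (p^m×1 k)) (trans (×-congˡ (≡.sym N≡p^k)) N×1≈0)) (x^m≉0 ≉0 k)

    p∣m⇒m×x≈0 : ∀ {m} x → p ∣ m → m · x ≈ 0#
    p∣m⇒m×x≈0 {m} x (divides j m≡j*p) = begin
      m · x                      ≈⟨ ×-congʳ m (*-identityˡ x) ⟨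
      m · (1# * x)               ≈⟨ ×-assoc-* m 1# x ⟨
      (m · 1#) * x               ≈⟨ *-congʳ (×-congˡ m≡j*p) ⟩
      ((j ℕ.* p) · 1#) * x       ≈⟨ *-congʳ (×1-homo-* j p) ⟩
      ((j · 1#) * (p · 1#)) * x  ≈⟨ *-congʳ (trans (*-congˡ p×1≈0) (zeroʳ _)) ⟩
      0# * x                     ≈⟨ zeroˡ x ⟩
      0#                         ∎

    ^p-distrib-+ : ∀ x y → (x + y) ^ p ≈ x ^ p + y ^ p
    ^p-distrib-+ x y = freshman p ≡.refl
      where
      open Binomial commutativeSemiring using (theorem; binomialTerm)
      -- The exponent is generalised to a variable `m` equal to `p`, so that it can be matched as a
      -- successor and the binomial sum split into first, middle and last terms.
      freshman : ∀ m → m ≡ p → (x + y) ^ m ≈ x ^ m + y ^ m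
      freshman zero    0≡p = contradiction (≡.sym 0≡p) (ℕ.≢-nonZero⁻¹ p {{prime⇒nonZero p-prime}})
      freshman (suc m) 1+m≡p = begin
        (x + y) ^ suc m                           ≈⟨ theorem (suc m) x y ⟩
        t zero + sum (tail t)                     ≈⟨ +-congˡ (sum-init-last (tail t)) ⟩
        t zero + (sum (middle) + t (fromℕ (suc m))) ≈⟨ +-cong first (+-cong (trans (sum-cong-≋ middle≈0) (sum-replicate-zero m)) last≈) ⟩
        y ^ suc m + (0# + x ^ suc m)              ≈⟨ +-congˡ (+-identityˡ _) ⟩
        y ^ suc m + x ^ suc m                     ≈⟨ +-comm _ _ ⟩
        x ^ suc m + y ^ suc m                     ∎
        where
        t : Vector Carrier (suc (suc m))
        t = binomialTerm x y (suc m)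

        middle : Vector Carrier m
        middle i = t (suc (inject₁ i))

        first : t zero ≈ y ^ suc m
        first = trans (+-identityʳ _) (*-identityˡ _)

        last≈ : t (fromℕ (suc m)) ≈ x ^ suc m
        last≈ rewrite Fin.toℕ-fromℕ m | nCn≡1 (suc m) | ℕ.n∸n≡0 m = trans (+-identityʳ _) (*-identityʳ _)

        middle≈0 : ∀ i → middle i ≈ 0#
        middle≈0 i = p∣m⇒m×x≈0 _ (≡.subst (λ r → r ∣ suc m choose toℕ (suc (inject₁ i))) 1+m≡p
          (prime∣pCk (≡.subst Prime (≡.sym 1+m≡p) p-prime) (s≤s z≤n)
            (s≤s (≡.subst (ℕ._< m) (≡.sym (Fin.toℕ-inject₁ i)) (Fin.toℕ<n i)))))

    ^p^m-distrib-+ : ∀ m x y → (x + y) ^ (p ℕ.^ m) ≈ x ^ (p ℕ.^ m) + y ^ (p ℕ.^ m)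
    ^p^m-distrib-+ zero    x y = trans (*-identityʳ _) (sym (+-cong (*-identityʳ x) (*-identityʳ y)))
    ^p^m-distrib-+ (suc m) x y = begin
      (x + y) ^ (p ℕ.* p ℕ.^ m)                         ≈⟨ ^-assocʳ (x + y) p (p ℕ.^ m) ⟨
      ((x + y) ^ p) ^ (p ℕ.^ m)                         ≈⟨ ^-congˡ (p ℕ.^ m) (^p-distrib-+ x y) ⟩
      (x ^ p + y ^ p) ^ (p ℕ.^ m)                       ≈⟨ ^p^m-distrib-+ m (x ^ p) (y ^ p) ⟩
      (x ^ p) ^ (p ℕ.^ m) + (y ^ p) ^ (p ℕ.^ m)         ≈⟨ +-cong (^-assocʳ x p _) (^-assocʳ y p _) ⟩
      x ^ (p ℕ.* p ℕ.^ m) + y ^ (p ℕ.* p ℕ.^ m)         ∎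

-- Roots of polynomials and independence of characters

module FiniteFieldCharacters
  {c ℓ₁ ℓ₂} (F : HeytingField c ℓ₁ ℓ₂) {N : ℕ} (finite : HasOrder F N)
  where

  open import Data.Vec.Base using ([]; _∷_; _++_; replicate)
  open HeytingCommutativeRing (HeytingField.heytingCommutativeRing F) using (commutativeRing)
  open CommutativeRing commutativeRing hiding (zero)
  open FiniteField F finite
  open Exp commutativeSemiring
  open SemiringSum semiring
  open AbelianGroupProperties +-abelianGroup using (∙-cancelˡ; x∙y⁻¹≈ε⇒x≈y)
  open RingProperties ring using ([y-z]x≈yx-zx; -1*x≈-x)
  open NaturalCoefficients commutativeSemiring using (solve; _:=_; _:+_; _:*_)
  open import Relation.Binary.Reasoning.Setoid setoid

  x*z≈y*z⇒z≈0 : ∀ {x y z} → ¬ x ≈ y → x * z ≈ y * z → z ≈ 0#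
  x*z≈y*z⇒z≈0 {x} {y} {z} x≉y xz≈yz = x*y≈0⇒y≈0 (x≉y ∘ x∙y⁻¹≈ε⇒x≈y x y) (begin
    (x - y) * z     ≈⟨ [y-z]x≈yx-zx z x y ⟩
    x * z - y * z   ≈⟨ +-congʳ xz≈yz ⟩
    y * z - y * z   ≈⟨ -‿inverseʳ (y * z) ⟩
    0#              ∎)

  -- The monic polynomial of degree d whose lower coefficients, constant
  -- term first, are the entries of the vector.
  monic : Vec Carrier d → Carrier → Carrier
  monic []      x = 1#
  monic (a ∷ p) x = a + x * monic p x

  quotient : Carrier → Vec Carrier (suc d) → Vec Carrier d
  quotient r (_ ∷ [])        = []
  quotient r (_ ∷ p@(_ ∷ _)) = monic p r ∷ quotient r p

  -- p(x) - p(r) = (x - r) (quotient r p)(x), without subtraction.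
  monic-quotient : ∀ r (p : Vec Carrier (suc d)) x →
    monic p x + r * monic (quotient r p) x ≈ monic p r + x * monic (quotient r p) x
  monic-quotient r (a ∷ []) x =
    solve 4 (λ a x r o → (a :+ x :* o) :+ r :* o := (a :+ r :* o) :+ x :* o) refl a x r 1#
  monic-quotient r (a ∷ p@(_ ∷ _)) x = begin
    (a + x * monic p x) + r * (monic p r + x * Q)
      ≈⟨ solve 6 (λ a x r P R Q → (a :+ x :* P) :+ r :* (R :+ x :* Q) := (a :+ r :* R) :+ x :* (P :+ r :* Q))
           refl a x r (monic p x) (monic p r) Q ⟩
    (a + r * monic p r) + x * (monic p x + r * Q)
      ≈⟨ +-congˡ (*-congˡ (monic-quotient r p x)) ⟩
    (a + r * monic p r) + x * (monic p r + x * Q) ∎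
    where Q = monic (quotient r p) x

  -- Division by the linear factor of the first root leaves a monic polynomial of smaller degree
  -- that vanishes at all the other roots; in degree zero the polynomial is `1#`.
  too-many-roots : (p : Vec Carrier d) (r : Vector Carrier (suc d)) →
    (∀ i j → i ≢ j → ¬ r i ≈ r j) → ¬ (∀ i → monic p (r i) ≈ 0#)
  too-many-roots {zero}  []  r _ root = 1≉0 (root zero)
  too-many-roots {suc d} p r distinct root =
    too-many-roots (quotient r₀ p) (tail r) (λ i j i≢j → distinct (suc i) (suc j) (i≢j ∘ Fin.suc-injective))
      (λ i → x*z≈y*z⇒z≈0 (distinct zero (suc i) λ ()) (begin
        r₀ * q i                    ≈⟨ +-identityˡ _ ⟨
        0# + r₀ * q i               ≈⟨ +-congʳ (root (suc i)) ⟨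
        monic p (r (suc i)) + r₀ * q i ≈⟨ monic-quotient r₀ p (r (suc i)) ⟩
        monic p r₀ + r (suc i) * q i   ≈⟨ +-congʳ (root zero) ⟩
        0# + r (suc i) * q i        ≈⟨ +-identityˡ _ ⟩
        r (suc i) * q i             ∎))
    where
    r₀ = r zero
    q = λ i → monic (quotient r₀ p) (r (suc i))

  monic-replicate-0-++ : ∀ a (p : Vec Carrier d) x → monic (replicate a 0# ++ p) x ≈ x ^ a * monic p x
  monic-replicate-0-++ zero    p x = sym (*-identityˡ _)
  monic-replicate-0-++ (suc a) p x = trans (+-identityˡ _)
    (trans (*-congˡ (monic-replicate-0-++ a p x)) (sym (*-assoc x (x ^ a) (monic p x))))

  monic-replicate-0 : ∀ a x → monic (replicate a 0#) x ≈ x ^ a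
  monic-replicate-0 zero    x = refl
  monic-replicate-0 (suc a) x = trans (+-identityˡ _) (*-congˡ (monic-replicate-0 a x))

  -- Otherwise the monic polynomial `x ^ b - x ^ a`, of degree b smaller than N, would vanish on b +
  -- 1 distinct elements. With b = a + 1 + t its lower coefficients are a zeros, then `- 1#`, then t
  -- zeros.
  powers-differ : ∀ {a b} → a ℕ.< b → b ℕ.< N → ∃[ x ] ¬ x ^ a ≈ x ^ b
  powers-differ {a} {b} a<b b<N
    with any? (λ {x} {y} x≈y ≉ eq → ≉ (trans (^-congˡ a x≈y) (trans eq (^-congˡ b (sym x≈y)))))
              (λ x → ¬? ((x ^ a) ≟ (x ^ b)))
  ... | yes found = found
  ... | no none with t , ≡.refl ← ℕ.m≤n⇒∃[o]m+o≡n a<b =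
    contradiction (λ i → x^b-x^a≈0 (from (inject≤ i deg<N)))
      (too-many-roots (replicate a 0# ++ (- 1# ∷ replicate t 0#)) (λ i → from (inject≤ i deg<N))
        (λ i j i≢j fi≈fj → i≢j (Fin.inject≤-injective deg<N deg<N i j
          (≡.trans (≡.sym (strictlyInverseˡ _)) (≡.trans (to-cong fi≈fj) (strictlyInverseˡ _))))))
    where
    deg<N : suc (a ℕ.+ suc t) ℕ.≤ N
    deg<N = ≡.subst (ℕ._< N) (≡.sym (ℕ.+-suc a t)) b<N

    x^b-x^a≈0 : ∀ x → monic (replicate a 0# ++ (- 1# ∷ replicate t 0#)) x ≈ 0#
    x^b-x^a≈0 x = begin
      monic (replicate a 0# ++ (- 1# ∷ replicate t 0#)) x
        ≈⟨ monic-replicate-0-++ a (- 1# ∷ replicate t 0#) x ⟩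
      x ^ a * (- 1# + x * monic (replicate t 0#) x)
        ≈⟨ *-congˡ (+-congˡ (*-congˡ (monic-replicate-0 t x))) ⟩
      x ^ a * (- 1# + x ^ suc t)
        ≈⟨ distribˡ (x ^ a) (- 1#) (x ^ suc t) ⟩
      x ^ a * - 1# + x ^ a * x ^ suc t
        ≈⟨ +-cong (trans (*-comm _ _) (-1*x≈-x (x ^ a))) (sym (^-homo-* x a (suc t))) ⟩
      - (x ^ a) + x ^ (a ℕ.+ suc t)
        ≈⟨ +-congˡ (trans (^-congʳ x (ℕ.+-suc a t)) (sym x^a≈x^b)) ⟩
      - (x ^ a) + x ^ a
        ≈⟨ -‿inverseˡ (x ^ a) ⟩
      0# ∎
      where
      x^a≈x^b : x ^ a ≈ x ^ suc (a ℕ.+ t)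
      x^a≈x^b = decidable-stable ((x ^ a) ≟ (x ^ suc (a ℕ.+ t))) (λ ≉ → none (x , ≉))

  -- Dedekind's argument: the relation at y * x minus χ₀(y) times the relation
  -- at x no longer involves χ₀.
  characters-independent : (χ : Fin n → Carrier → Carrier) →
    (∀ i → χ i 1# ≈ 1#) → (∀ i x y → χ i (x * y) ≈ χ i x * χ i y) →
    (∀ i j → i ≢ j → ∃[ x ] ¬ χ i x ≈ χ j x) →
    (h : Vector Carrier n) → (∀ x → sum (λ i → h i * χ i x) ≈ 0#) → ∀ i → h i ≈ 0#
  characters-independent {suc n} χ χ-1 χ-* χ-distinct h Σ≈0 = λ where
      zero    → h₀≈0
      (suc i) → hᵢ≈0 i
    where
    S : Carrier → Carrier
    S x = sum (λ i → h (suc i) * χ (suc i) x)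

    hᵢ≈0 : ∀ i → h (suc i) ≈ 0#
    hᵢ≈0 i with y , χᵢy≉χ₀y ← χ-distinct (suc i) zero (λ ()) =
      x*y≈0⇒y≈0 (χᵢy≉χ₀y ∘ x∙y⁻¹≈ε⇒x≈y _ _)
        (trans (*-comm _ _) (characters-independent (χ ∘ suc) (χ-1 ∘ suc) (χ-* ∘ suc)
          (λ j k j≢k → χ-distinct (suc j) (suc k) (j≢k ∘ Fin.suc-injective)) g Σg≈0 i))
      where
      g : Vector Carrier n
      g j = h (suc j) * (χ (suc j) y - χ zero y)

      χ₀yS≈S : ∀ x → χ zero y * S x ≈ S (y * x)
      χ₀yS≈S x = ∙-cancelˡ (χ zero y * (h zero * χ zero x)) _ _ (begin
        χ zero y * (h zero * χ zero x) + χ zero y * S x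
          ≈⟨ distribˡ (χ zero y) _ _ ⟨
        χ zero y * (h zero * χ zero x + S x)
          ≈⟨ trans (*-congˡ (Σ≈0 x)) (zeroʳ _) ⟩
        0#
          ≈⟨ Σ≈0 (y * x) ⟨
        h zero * χ zero (y * x) + S (y * x)
          ≈⟨ +-congʳ (trans (*-congˡ (χ-* zero y x))
               (solve 3 (λ h u v → h :* (u :* v) := u :* (h :* v)) refl (h zero) (χ zero y) (χ zero x))) ⟩
        χ zero y * (h zero * χ zero x) + S (y * x) ∎)

      Σg≈0 : ∀ x → sum (λ j → g j * χ (suc j) x) ≈ 0#
      Σg≈0 x = ∙-cancelˡ (χ zero y * S x) _ _ (begin
        χ zero y * S x + sum (λ j → g j * χ (suc j) x)
          ≈⟨ +-congʳ (*-distribˡ-sum (χ zero y) (λ j → h (suc j) * χ (suc j) x)) ⟩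
        sum (λ j → χ zero y * (h (suc j) * χ (suc j) x)) + sum (λ j → g j * χ (suc j) x)
          ≈⟨ ∑-distrib-+ (λ j → χ zero y * (h (suc j) * χ (suc j) x)) (λ j → g j * χ (suc j) x) ⟨
        sum (λ j → χ zero y * (h (suc j) * χ (suc j) x) + g j * χ (suc j) x)
          ≈⟨ sum-cong-≋ term ⟩
        S (y * x)
          ≈⟨ χ₀yS≈S x ⟨
        χ zero y * S x
          ≈⟨ +-identityʳ _ ⟨
        χ zero y * S x + 0# ∎)
        where
        term : ∀ j → χ zero y * (h (suc j) * χ (suc j) x) + g j * χ (suc j) x ≈ h (suc j) * χ (suc j) (y * x)
        term j = begin
          χ zero y * (hⱼ * χ (suc j) x) + hⱼ * (χ (suc j) y - χ zero y) * χ (suc j) x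
            ≈⟨ solve 4 (λ a b hⱼ u → a :* (hⱼ :* u) :+ hⱼ :* b :* u := hⱼ :* ((a :+ b) :* u)) refl
                 (χ zero y) (χ (suc j) y - χ zero y) hⱼ (χ (suc j) x) ⟩
          hⱼ * ((χ zero y + (χ (suc j) y - χ zero y)) * χ (suc j) x)
            ≈⟨ *-congˡ (*-congʳ a+[b-a]≈b) ⟩
          hⱼ * (χ (suc j) y * χ (suc j) x)
            ≈⟨ *-congˡ (χ-* (suc j) y x) ⟨
          hⱼ * χ (suc j) (y * x) ∎
          where
          hⱼ = h (suc j)
          a+[b-a]≈b : χ zero y + (χ (suc j) y - χ zero y) ≈ χ (suc j) y
          a+[b-a]≈b = trans (+-comm _ _) (trans (+-assoc _ _ _) (trans (+-congˡ (-‿inverseˡ _)) (+-identityʳ _)))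

    -- Once the other coefficients vanish, the relation at `1#` reads `h zero ≈ 0#`, since
    -- characters take the value `1#` there.
    h₀≈0 : h zero ≈ 0#
    h₀≈0 = begin
      h zero                         ≈⟨ *-identityʳ _ ⟨
      h zero * 1#                    ≈⟨ *-congˡ (χ-1 zero) ⟨
      h zero * χ zero 1#             ≈⟨ +-identityʳ _ ⟨
      h zero * χ zero 1# + 0#        ≈⟨ +-congˡ S≈0 ⟨
      h zero * χ zero 1# + S 1#      ≈⟨ Σ≈0 1# ⟩
      0#                             ∎
      where
      S≈0 : S 1# ≈ 0#
      S≈0 = trans (sum-cong-≋ (λ i → trans (*-congʳ (hᵢ≈0 i)) (zeroˡ _))) (sum-replicate-zero n)

open import Data.Vec.Functional using (_∷_; []; _++_; removeAt)

-- Linear algebra over a finite field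

module FiniteFieldLinearAlgebra
  {c ℓ₁ ℓ₂} (F : HeytingField c ℓ₁ ℓ₂) {N : ℕ} (finite : HasOrder F N)
  {m ℓm} (M : LeftModule (CommutativeRing.ring (HeytingCommutativeRing.commutativeRing
    (HeytingField.heytingCommutativeRing F))) m ℓm)
  (_≟ᴹ_ : B.Decidable (LeftModule._≈ᴹ_ M))
  where

  open HeytingCommutativeRing (HeytingField.heytingCommutativeRing F) using (commutativeRing)
  open CommutativeRing commutativeRing hiding (zero)
  open LeftModule M
  open LinearAlgebra M U
  open FiniteField F finite
  open Sum +ᴹ-commutativeMonoid
  open LeftModuleProperties M
  open RingProperties ring using () renaming (-1*x≈-x to -1*a≈-a)
  open import Relation.Binary.Reasoning.Setoid ≈ᴹ-setoid

  -1*x≈-x : ∀ x → (- 1#) *ₗ x ≈ᴹ -ᴹ x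
  -1*x≈-x x = inverseˡ-uniqueᴹ _ _ (begin
    (- 1#) *ₗ x +ᴹ x       ≈⟨ +ᴹ-congˡ (*ₗ-identityˡ x) ⟨
    (- 1#) *ₗ x +ᴹ 1# *ₗ x ≈⟨ *ₗ-distribʳ x (- 1#) 1# ⟨
    (- 1# + 1#) *ₗ x       ≈⟨ *ₗ-congʳ (-‿inverseˡ 1#) ⟩
    0# *ₗ x                ≈⟨ *ₗ-zeroˡ x ⟩
    0ᴹ                     ∎)

  -- The difference is written with the scalar `- 1#` because `IsSubspace` provides closure under
  -- `+ᴹ` and `*ₗ`, from which membership of differences then follows directly.
  x+y≈z⇒y≈z-x : ∀ {x y z} → x +ᴹ y ≈ᴹ z → y ≈ᴹ z +ᴹ (- 1#) *ₗ x
  x+y≈z⇒y≈z-x {x} {y} {z} x+y≈z = begin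
    y                       ≈⟨ +ᴹ-identityʳ y ⟨
    y +ᴹ 0ᴹ                 ≈⟨ +ᴹ-congˡ (-ᴹ‿inverseʳ x) ⟨
    y +ᴹ (x +ᴹ -ᴹ x)        ≈⟨ +ᴹ-assoc y x (-ᴹ x) ⟨
    (y +ᴹ x) +ᴹ -ᴹ x        ≈⟨ +ᴹ-cong (≈ᴹ-trans (+ᴹ-comm y x) x+y≈z) (≈ᴹ-sym (-1*x≈-x x)) ⟩
    z +ᴹ (- 1#) *ₗ x        ∎

  combination-cong : ∀ {c c′ : Vector Carrier d} {v v′ : Vector Carrierᴹ d} →
    (∀ i → c i ≈ c′ i) → (∀ i → v i ≈ᴹ v′ i) → combination c v ≈ᴹ combination c′ v′
  combination-cong c≈c′ v≈v′ = sum-cong-≋ (λ i → *ₗ-cong (c≈c′ i) (v≈v′ i))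

  combination-+ : ∀ (c c′ : Vector Carrier d) v →
    combination (λ i → c i + c′ i) v ≈ᴹ combination c v +ᴹ combination c′ v
  combination-+ c c′ v = ≈ᴹ-trans
    (sum-cong-≋ (λ i → *ₗ-distribʳ (v i) (c i) (c′ i)))
    (∑-distrib-+ (λ i → c i *ₗ v i) (λ i → c′ i *ₗ v i))

  *-combination : ∀ a (c : Vector Carrier d) v →
    combination (λ i → a * c i) v ≈ᴹ a *ₗ combination c v
  *-combination {zero}  a c v = ≈ᴹ-sym (*ₗ-zeroʳ a)
  *-combination {suc d} a c v = begin
    (a * c zero) *ₗ v zero +ᴹ combination (λ i → a * c (suc i)) (tail v)
      ≈⟨ +ᴹ-cong (*ₗ-assoc a (c zero) (v zero)) (*-combination a (tail c) (tail v)) ⟩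
    a *ₗ (c zero *ₗ v zero) +ᴹ a *ₗ combination (tail c) (tail v)
      ≈⟨ *ₗ-distribˡ a _ _ ⟨
    a *ₗ combination c v ∎

  combination-0 : ∀ (v : Vector Carrierᴹ d) → combination (λ _ → 0#) v ≈ᴹ 0ᴹ
  combination-0 {d} v = ≈ᴹ-trans (sum-cong-≋ (λ i → *ₗ-zeroˡ (v i))) (sum-replicate-zero d)

  combination-++ : ∀ (c : Vector Carrier (d ℕ.+ e)) (xs : Vector Carrierᴹ d) (ys : Vector Carrierᴹ e) →
    combination c (xs ++ ys) ≈ᴹ combination (c ∘ (_↑ˡ e)) xs +ᴹ combination (c ∘ (d ↑ʳ_)) ys
  combination-++ {zero}  c xs ys = ≈ᴹ-sym (+ᴹ-identityˡ _)
  combination-++ {suc d} {e} c xs ys = begin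
    c zero *ₗ xs zero +ᴹ combination (tail c) (tail (xs ++ ys))
      ≈⟨ +ᴹ-congˡ (combination-cong (λ _ → refl) tail-++) ⟩
    c zero *ₗ xs zero +ᴹ combination (tail c) (tail xs ++ ys)
      ≈⟨ +ᴹ-congˡ (combination-++ (tail c) (tail xs) ys) ⟩
    c zero *ₗ xs zero +ᴹ (combination (tail (c ∘ (_↑ˡ e))) (tail xs) +ᴹ combination (c ∘ (suc d ↑ʳ_)) ys)
      ≈⟨ +ᴹ-assoc _ _ _ ⟨
    combination (c ∘ (_↑ˡ e)) xs +ᴹ combination (c ∘ (suc d ↑ʳ_)) ys ∎
    where
    tail-++ : ∀ i → tail (xs ++ ys) i ≈ᴹ (tail xs ++ ys) i
    tail-++ i with splitAt d i
    ... | inj₁ _ = ≈ᴹ-refl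
    ... | inj₂ _ = ≈ᴹ-refl

  combination-∈ : {W : Pred Carrierᴹ w} → IsSubspace W →
    ∀ (c : Vector Carrier d) {v} → (∀ i → v i ∈ W) → combination c v ∈ W
  combination-∈ {d = zero}  W-sub c v∈W = IsSubspace.0ᴹ-closed W-sub
  combination-∈ {d = suc d} W-sub c v∈W =
    +ᴹ-closed (*ₗ-closed tt (v∈W zero)) (combination-∈ W-sub (tail c) (v∈W ∘ suc))
    where open IsSubspace W-sub

  span-least : {W : Pred Carrierᴹ w} → IsSubspace W →
    {v : Vector Carrierᴹ d} → (∀ i → v i ∈ W) → ⟨ v ⟩ ⊆ W
  span-least W-sub v∈W (c , _ , x≈) =
    IsSubspace.resp-≈ᴹ W-sub (≈ᴹ-sym x≈) (combination-∈ W-sub c v∈W)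

  span-isSubspace : (v : Vector Carrierᴹ d) → IsSubspace ⟨ v ⟩
  span-isSubspace v = record
    { resp-≈ᴹ   = λ x≈y (c , _ , x≈) → c , _ , ≈ᴹ-trans (≈ᴹ-sym x≈y) x≈
    ; 0ᴹ-closed = (λ _ → 0#) , _ , ≈ᴹ-sym (combination-0 v)
    ; +ᴹ-closed = λ (c , _ , x≈) (c′ , _ , y≈) → (λ i → c i + c′ i) , _ ,
        ≈ᴹ-trans (+ᴹ-cong x≈ y≈) (≈ᴹ-sym (combination-+ c c′ v))
    ; *ₗ-closed = λ {a} _ (c , _ , x≈) → (λ i → a * c i) , _ ,
        ≈ᴹ-trans (*ₗ-congˡ x≈) (≈ᴹ-sym (*-combination a c v))
    }

  span-tail : (v : Vector Carrierᴹ (suc d)) → ⟨ tail v ⟩ ⊆ ⟨ v ⟩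
  span-tail v (c , _ , x≈) = (0# ∷ c) , _ ,
    ≈ᴹ-trans x≈ (≈ᴹ-sym (≈ᴹ-trans (+ᴹ-congʳ (*ₗ-zeroˡ (v zero))) (+ᴹ-identityˡ _)))

  ∈-span : (v : Vector Carrierᴹ d) → ∀ i → v i ∈ ⟨ v ⟩
  ∈-span {suc d} v zero = (1# ∷ λ _ → 0#) , _ , ≈ᴹ-sym
    (≈ᴹ-trans (+ᴹ-cong (*ₗ-identityˡ (v zero)) (combination-0 (tail v))) (+ᴹ-identityʳ (v zero)))
  ∈-span {suc d} v (suc i) = span-tail v (∈-span (tail v) i)

  -- Independence is not part of the notion: when the number of generators equals the dimension,
  -- `spanning⇒independent` supplies it.
  _SpannedBy_ : Pred Carrierᴹ w → Vector Carrierᴹ d → Set _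
  W SpannedBy v = (∀ i → v i ∈ W) × W ⊆ ⟨ v ⟩

  spannedBy⇒≐ : {W : Pred Carrierᴹ w} → IsSubspace W → {v : Vector Carrierᴹ d} →
    W SpannedBy v → W ≐ ⟨ v ⟩
  spannedBy⇒≐ W-sub (v∈W , W⊆) = W⊆ , span-least W-sub v∈W

  spannedBy-resp : {W : Pred Carrierᴹ w} → IsSubspace W → {u v : Vector Carrierᴹ d} →
    (∀ i → u i ≈ᴹ v i) → W SpannedBy u → W SpannedBy v
  spannedBy-resp W-sub {u} {v} u≈v (u∈W , W⊆) =
    (λ i → IsSubspace.resp-≈ᴹ W-sub (u≈v i) (u∈W i)) ,
    span-least (span-isSubspace v)
      (λ i → IsSubspace.resp-≈ᴹ (span-isSubspace v) (≈ᴹ-sym (u≈v i)) (∈-span v i)) ∘ W⊆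

  ++-all : (P : Pred Carrierᴹ a) (xs : Vector Carrierᴹ d) (ys : Vector Carrierᴹ e) →
    (∀ i → xs i ∈ P) → (∀ j → ys j ∈ P) → ∀ k → (xs ++ ys) k ∈ P
  ++-all {d = d} _ _ _ xs∈P ys∈P k with splitAt d k
  ... | inj₁ i = xs∈P i
  ... | inj₂ j = ys∈P j

  ∈-span-++ˡ : (xs : Vector Carrierᴹ d) (ys : Vector Carrierᴹ e) → ∀ i → xs i ∈ ⟨ xs ++ ys ⟩
  ∈-span-++ˡ {d} {e} xs ys i = ≡.subst (_∈ ⟨ xs ++ ys ⟩) lookup-++ˡ (∈-span (xs ++ ys) (i ↑ˡ e))
    where
    lookup-++ˡ : (xs ++ ys) (i ↑ˡ e) ≡ xs i
    lookup-++ˡ rewrite Fin.splitAt-↑ˡ d i e = ≡.refl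

  ∈-span-++ʳ : (xs : Vector Carrierᴹ d) (ys : Vector Carrierᴹ e) → ∀ j → ys j ∈ ⟨ xs ++ ys ⟩
  ∈-span-++ʳ {d} {e} xs ys j = ≡.subst (_∈ ⟨ xs ++ ys ⟩) lookup-++ʳ (∈-span (xs ++ ys) (d ↑ʳ j))
    where
    lookup-++ʳ : (xs ++ ys) (d ↑ʳ j) ≡ ys j
    lookup-++ʳ rewrite Fin.splitAt-↑ʳ d e j = ≡.refl

  _∈span?_ : B.Decidable (λ x (v : Vector Carrierᴹ d) → x ∈ ⟨ v ⟩)
  x ∈span? v = map′ (λ (c , x≈) → c , _ , x≈) (λ (c , _ , x≈) → c , x≈)
    (anyᵛ? (λ c≈c′ x≈ → ≈ᴹ-trans x≈ (combination-cong c≈c′ (λ _ → ≈ᴹ-refl)))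
           (λ c → x ≟ᴹ combination c v))

  independent-∷ : ∀ {x} (v : Vector Carrierᴹ d) → LinearlyIndependent v → x ∉ ⟨ v ⟩ →
    LinearlyIndependent (x ∷ v)
  independent-∷ {x = x} v v-ind x∉ c _ cv≈0 with c zero ≟ 0#
  ... | yes c₀≈0 = λ where
        zero    → c₀≈0
        (suc i) → v-ind (tail c) _ (begin
          combination (tail c) v                   ≈⟨ +ᴹ-identityˡ _ ⟨
          0ᴹ +ᴹ combination (tail c) v             ≈⟨ +ᴹ-congʳ (≈ᴹ-trans (*ₗ-congʳ c₀≈0) (*ₗ-zeroˡ x)) ⟨
          combination c (x ∷ v)                    ≈⟨ cv≈0 ⟩
          0ᴹ                                       ∎) i
  ... | no c₀≉0 = contradiction x∈ x∉
    where
    c₀⁻¹ = proj₁ (inverse c₀≉0)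
    x∈ : x ∈ ⟨ v ⟩
    x∈ = resp-≈ᴹ x≈ (*ₗ-closed tt (+ᴹ-closed 0ᴹ-closed (*ₗ-closed tt (combination-∈ (span-isSubspace v) (tail c) (∈-span v)))))
      where
      open IsSubspace (span-isSubspace v)
      x≈ : c₀⁻¹ *ₗ (0ᴹ +ᴹ (- 1#) *ₗ combination (tail c) v) ≈ᴹ x
      x≈ = begin
        c₀⁻¹ *ₗ (0ᴹ +ᴹ (- 1#) *ₗ combination (tail c) v)
          ≈⟨ *ₗ-congˡ (x+y≈z⇒y≈z-x (≈ᴹ-trans (+ᴹ-comm _ _) cv≈0)) ⟨
        c₀⁻¹ *ₗ (c zero *ₗ x) ≈⟨ *ₗ-assoc c₀⁻¹ (c zero) x ⟨
        (c₀⁻¹ * c zero) *ₗ x  ≈⟨ *ₗ-congʳ (proj₂ (inverse c₀≉0)) ⟩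
        1# *ₗ x               ≈⟨ *ₗ-identityˡ x ⟩
        x                     ∎

  -- The coefficients of combinations of v with respect to u inject
  -- F ^ d into F ^ e, so d ≤ e by counting.
  independent⇒≤ : {v : Vector Carrierᴹ d} {u : Vector Carrierᴹ e} →
    LinearlyIndependent v → (∀ i → v i ∈ ⟨ u ⟩) → d ℕ.≤ e
  independent⇒≤ {d} {e} {v} {u} v-ind v∈ =
    ℕ.≮⇒≥ λ e<d → ℕ.<⇒≱ (ℕ.^-monoʳ-< N 1<N e<d) (Fin.injective⇒≤ coefficients-injective)
    where
    coefficients : Vector Carrier d → Vector Carrier e
    coefficients c = proj₁ (combination-∈ (span-isSubspace u) c v∈)

    coefficients-spec : ∀ c → combination c v ≈ᴹ combination (coefficients c) u
    coefficients-spec c = proj₂ (proj₂ (combination-∈ (span-isSubspace u) c v∈))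

    combination-injective : ∀ {c c′} → combination c v ≈ᴹ combination c′ v → ∀ i → c i ≈ c′ i
    combination-injective {c} {c′} eq i =
      trans (sym (+-identityʳ (c i))) (trans (+-congˡ (sym (-‿inverseˡ (c′ i))))
      (trans (sym (+-assoc (c i) (- c′ i) (c′ i))) (trans (+-congʳ (c-c′≈0 i)) (+-identityˡ (c′ i)))))
      where
      -c′≈ : ∀ i → (- 1#) * c′ i ≈ - c′ i
      -c′≈ i = -1*a≈-a (c′ i)
      c-c′≈0 : ∀ i → c i - c′ i ≈ 0#
      c-c′≈0 = v-ind (λ i → c i - c′ i) _ (begin
        combination (λ i → c i - c′ i) v
          ≈⟨ combination-+ c (λ i → - c′ i) v ⟩
        combination c v +ᴹ combination (λ i → - c′ i) v
          ≈⟨ +ᴹ-congˡ (combination-cong -c′≈ (λ _ → ≈ᴹ-refl)) ⟨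
        combination c v +ᴹ combination (λ i → (- 1#) * c′ i) v
          ≈⟨ +ᴹ-cong eq (≈ᴹ-trans (*-combination (- 1#) c′ v) (-1*x≈-x _)) ⟩
        combination c′ v +ᴹ -ᴹ combination c′ v
          ≈⟨ -ᴹ‿inverseʳ _ ⟩
        0ᴹ ∎)

    coefficients-injective : ∀ {j k} → encode (coefficients (decode {d} j)) ≡ encode (coefficients (decode {d} k)) → j ≡ k
    coefficients-injective {j} {k} eq =
      ≡.trans (≡.sym (encode-decode {d} j)) (≡.trans (encode-cong (combination-injective (begin
        combination (decode j) v                ≈⟨ coefficients-spec (decode j) ⟩
        combination (coefficients (decode j)) u ≈⟨ combination-cong coefficients-eq (λ _ → ≈ᴹ-refl) ⟩
        combination (coefficients (decode k)) u ≈⟨ coefficients-spec (decode k) ⟨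
        combination (decode k) v                ∎))) (encode-decode {d} k))
      where
      coefficients-eq : ∀ i → coefficients (decode j) i ≈ coefficients (decode k) i
      coefficients-eq i = trans (sym (decode-encode _ i))
        (trans (reflexive (≡.cong (λ l → decode {e} l i) eq)) (decode-encode _ i))

  module _ {W : Pred Carrierᴹ w} (W-dim : HasDimension W d) where
    private
      basis = proj₁ W-dim
      W≐ = proj₂ (proj₂ W-dim)

    -- A basis makes an arbitrary predicate decidable, by searching for the coefficients. This is
    -- what allows searches inside intersections and cores.
    dimension⇒∈? : Decidable W
    dimension⇒∈? x = map′ (proj₂ W≐) (proj₁ W≐) (x ∈span? basis)

    dimension⇒isSubspace : IsSubspace W
    dimension⇒isSubspace = record
      { resp-≈ᴹ   = λ x≈y → proj₂ W≐ ∘ resp-≈ᴹ x≈y ∘ proj₁ W≐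
      ; 0ᴹ-closed = proj₂ W≐ 0ᴹ-closed
      ; +ᴹ-closed = λ x∈ y∈ → proj₂ W≐ (+ᴹ-closed (proj₁ W≐ x∈) (proj₁ W≐ y∈))
      ; *ₗ-closed = λ _ x∈ → proj₂ W≐ (*ₗ-closed tt (proj₁ W≐ x∈))
      }
      where open IsSubspace (span-isSubspace basis)

    dimension-≐ : {W′ : Pred Carrierᴹ b} → W ≐ W′ → HasDimension W′ d
    dimension-≐ (W⊆W′ , W′⊆W) =
      basis , proj₁ (proj₂ W-dim) , (proj₁ W≐ ∘ W′⊆W) , (W⊆W′ ∘ proj₂ W≐)

    dimension≤ : {u : Vector Carrierᴹ e} → W ⊆ ⟨ u ⟩ → d ℕ.≤ e
    dimension≤ W⊆ = independent⇒≤ (proj₁ (proj₂ W-dim)) (λ i → W⊆ (proj₂ W≐ (∈-span basis i)))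

    -- A vector of `W` outside `⟨ v ⟩` would give d + 1 independent vectors in the span of d basis
    -- vectors.
    independent-spans : {v : Vector Carrierᴹ d} → LinearlyIndependent v → (∀ i → v i ∈ W) → W ⊆ ⟨ v ⟩
    independent-spans {v} v-ind v∈W {x} x∈W = decidable-stable (x ∈span? v) λ x∉ →
      ℕ.1+n≰n (independent⇒≤ {v = x ∷ v} (independent-∷ v v-ind x∉)
        λ { zero → proj₁ W≐ x∈W ; (suc i) → proj₁ W≐ (v∈W i) })

    dimension-⊆ : {X : Pred Carrierᴹ b} → HasDimension X e → W ⊆ X → d ℕ.≤ e
    dimension-⊆ (_ , _ , X≐) W⊆X = dimension≤ (proj₁ X≐ ∘ W⊆X)

  dimension-≡⇒⊇ : {W : Pred Carrierᴹ w} {X : Pred Carrierᴹ b} →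
    HasDimension W d → HasDimension X d → W ⊆ X → X ⊆ W
  dimension-≡⇒⊇ (v , v-ind , W≐) X-dim W⊆X =
    proj₂ W≐ ∘ independent-spans X-dim v-ind (λ i → W⊆X (proj₂ W≐ (∈-span v i)))

  -- A nonzero coefficient in a relation makes the corresponding generator redundant, so fewer
  -- vectors than the dimension would span `W`.
  spanning⇒independent : {W : Pred Carrierᴹ w} → HasDimension W d → {v : Vector Carrierᴹ d} →
    W SpannedBy v → LinearlyIndependent v
  spanning⇒independent {d = zero} W-dim _ c _ _ ()
  spanning⇒independent {d = suc d} W-dim {v} (v∈W , W⊆) c _ cv≈0 i =
    decidable-stable (c i ≟ 0#) λ cᵢ≉0 →
      ℕ.1+n≰n (dimension≤ W-dim {u = removeAt v i} (span-least rest-sub (v∈ cᵢ≉0) ∘ W⊆))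
    where
    rest-sub = span-isSubspace (removeAt v i)
    open IsSubspace rest-sub
    vᵢ∈ : ¬ c i ≈ 0# → v i ∈ ⟨ removeAt v i ⟩
    vᵢ∈ cᵢ≉0 with y , y*cᵢ≈1 ← inverse cᵢ≉0 = resp-≈ᴹ vᵢ≈
      (*ₗ-closed tt (+ᴹ-closed 0ᴹ-closed (*ₗ-closed tt
        (combination-∈ rest-sub (removeAt c i) (∈-span (removeAt v i))))))
      where
      vᵢ≈ : y *ₗ (0ᴹ +ᴹ (- 1#) *ₗ combination (removeAt c i) (removeAt v i)) ≈ᴹ v i
      vᵢ≈ = begin
        y *ₗ (0ᴹ +ᴹ (- 1#) *ₗ combination (removeAt c i) (removeAt v i))
          ≈⟨ *ₗ-congˡ (x+y≈z⇒y≈z-x (≈ᴹ-trans (+ᴹ-comm _ _)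
              (≈ᴹ-trans (≈ᴹ-sym (sum-remove {i = i} (λ j → c j *ₗ v j))) cv≈0))) ⟨
        y *ₗ (c i *ₗ v i) ≈⟨ *ₗ-assoc y (c i) (v i) ⟨
        (y * c i) *ₗ v i  ≈⟨ *ₗ-congʳ y*cᵢ≈1 ⟩
        1# *ₗ v i         ≈⟨ *ₗ-identityˡ (v i) ⟩
        v i               ∎
    v∈ : ¬ c i ≈ 0# → ∀ j → v j ∈ ⟨ removeAt v i ⟩
    v∈ cᵢ≉0 j with i Fin.≟ j
    ... | yes ≡.refl = vᵢ∈ cᵢ≉0
    ... | no i≢j = ≡.subst (λ k → v k ∈ ⟨ removeAt v i ⟩) (Fin.punchIn-punchOut i≢j)
                     (∈-span (removeAt v i) _)

  -- No basis of `W` is required: the search runs through all combinations of `u` and tests each for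
  -- membership. Hence it applies to a core before its dimension is known.
  search-outside : {W : Pred Carrierᴹ w} → IsSubspace W → Decidable W →
    {u : Vector Carrierᴹ e} → W ⊆ ⟨ u ⟩ → (v : Vector Carrierᴹ d) →
    Dec (∃[ x ] (x ∈ W × x ∉ ⟨ v ⟩))
  search-outside W-sub W? {u} W⊆ v = map′
    (λ (c , Pc) → combination c u , Pc)
    (λ (x , x∈W , x∉) → let c , _ , x≈ = W⊆ x∈W in
      c , resp-≈ᴹ x≈ x∈W , x∉ ∘ IsSubspace.resp-≈ᴹ v-sub (≈ᴹ-sym x≈))
    (anyᵛ? (λ c≈c′ (∈W , ∉v) → let eq = combination-cong c≈c′ (λ _ → ≈ᴹ-refl) in
              resp-≈ᴹ eq ∈W , ∉v ∘ IsSubspace.resp-≈ᴹ v-sub (≈ᴹ-sym eq))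
           (λ c → W? (combination c u) ×-dec ¬? (combination c u ∈span? v)))
    where
    open IsSubspace W-sub
    v-sub = span-isSubspace v

  exists-outside : {W : Pred Carrierᴹ w} → HasDimension W d → e ℕ.< d → (v : Vector Carrierᴹ e) →
    ∃[ x ] (x ∈ W × x ∉ ⟨ v ⟩)
  exists-outside W-dim e<d v
    with search-outside (dimension⇒isSubspace W-dim) (dimension⇒∈? W-dim) (proj₁ (proj₂ (proj₂ W-dim))) v
  ... | yes found = found
  ... | no none = contradiction
        (dimension≤ W-dim λ {x} x∈W → decidable-stable (x ∈span? v) λ x∉ → none (x , x∈W , x∉))
        (ℕ.<⇒≱ e<d)

  -- Greedy extension to a basis. `Inv` transports data along with each added vector: nothing of
  -- interest in `hasDimension`, a second independent family in `dimension-∩`.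
  extend : {W : Pred Carrierᴹ w} → IsSubspace W → Decidable W →
    {u : Vector Carrierᴹ e} → W ⊆ ⟨ u ⟩ →
    (Inv : ∀ {d} → Vector Carrierᴹ d → Set a) →
    (∀ {d x} {v : Vector Carrierᴹ d} → Inv v → x ∈ W → x ∉ ⟨ v ⟩ → Inv (x ∷ v)) →
    (v : Vector Carrierᴹ d) → LinearlyIndependent v → (∀ i → v i ∈ W) → Inv v →
    ∃₂ λ d (v : Vector Carrierᴹ d) → LinearlyIndependent v × W SpannedBy v × Inv v
  extend {e = e} {W = W} W-sub W? {u} W⊆ Inv step v v-ind v∈W inv =
    go e v v-ind v∈W inv (ℕ.m≤m+n e _)
    where
    go : ∀ fuel {d} (v : Vector Carrierᴹ d) → LinearlyIndependent v → (∀ i → v i ∈ W) → Inv v →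
         e ℕ.≤ fuel ℕ.+ d →
         ∃₂ λ d (v : Vector Carrierᴹ d) → LinearlyIndependent v × W SpannedBy v × Inv v
    go fuel {d} v v-ind v∈W inv bound with search-outside W-sub W? W⊆ v
    ... | no none = d , v , v-ind ,
          (v∈W , λ {x} x∈W → decidable-stable (x ∈span? v) λ x∉ → none (x , x∈W , x∉)) , inv
    ... | yes (x , x∈W , x∉) = extended fuel bound
      where
      xv-ind = independent-∷ v v-ind x∉
      xv∈W : ∀ i → (x ∷ v) i ∈ W
      xv∈W zero    = x∈W
      xv∈W (suc i) = v∈W i
      extended : ∀ fuel → e ℕ.≤ fuel ℕ.+ d → _
      -- With no fuel left, the d + 1 independent vectors `x ∷ v` would lie in the span of the e
      -- vectors `u` although e is at most d.
      extended zero       bound = contradiction bound (ℕ.<⇒≱ (independent⇒≤ xv-ind (W⊆ ∘ xv∈W)))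
      extended (suc fuel) bound = go fuel (x ∷ v) xv-ind xv∈W (step inv x∈W x∉)
        (≡.subst (e ℕ.≤_) (≡.sym (ℕ.+-suc fuel d)) bound)

  hasDimension : {W : Pred Carrierᴹ w} → IsSubspace W → Decidable W →
    {u : Vector Carrierᴹ e} → W ⊆ ⟨ u ⟩ → ∃[ d ] HasDimension W d
  hasDimension W-sub W? W⊆
    with d , v , v-ind , W-span , _ ← extend W-sub W? W⊆ (λ _ → ℕ) (λ _ _ _ → 0)
           [] (λ _ _ _ ()) (λ ()) 0
    = d , v , v-ind , spannedBy⇒≐ W-sub W-span

  -- A basis of `A ∩ B` is extended to one of `A`, and the same new vectors are put in front of a
  -- basis of `B`. They stay independent because a vector of `A` in the span of the second family
  -- `v′` already lies in the span of the first family `v`. The second family has dA + dB - dI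
  -- members, all in `X`.
  dimension-∩ : {A : Pred Carrierᴹ a} {B : Pred Carrierᴹ b} {X : Pred Carrierᴹ w} → ∀ {dA dB dX dI} →
    HasDimension A dA → HasDimension B dB → HasDimension X dX → HasDimension (A ∩ B) dI →
    A ⊆ X → B ⊆ X → dA ℕ.+ dB ℕ.≤ dX ℕ.+ dI
  dimension-∩ {A = A} {B} {X} {dA} {dB} {dX} {dI} A-dim B-dim (x , x-ind , X≐) (i , i-ind , I≐) A⊆X B⊆X
    = let _ , _ , _ , A-span , _ , _ , v′-ind , v′∈X , d+dB≡d′+dI , _ = extension in
      ℕ.≤-trans (ℕ.+-monoˡ-≤ dB (dimension≤ A-dim (proj₂ A-span)))
        (ℕ.≤-trans (ℕ.≤-reflexive d+dB≡d′+dI)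
          (ℕ.+-monoˡ-≤ dI (independent⇒≤ v′-ind (λ j → proj₁ X≐ (v′∈X j)))))
    where
    A-sub = dimension⇒isSubspace A-dim

    Inv : ∀ {d} → Vector Carrierᴹ d → Set _
    Inv {d} v = ∃₂ λ d′ (v′ : Vector Carrierᴹ d′) → LinearlyIndependent v′ × (∀ j → v′ j ∈ X) ×
      d ℕ.+ dB ≡ d′ ℕ.+ dI × (∀ {y} → y ∈ A → y ∈ ⟨ v′ ⟩ → y ∈ ⟨ v ⟩)

    step : ∀ {d y} {v : Vector Carrierᴹ d} → Inv v → y ∈ A → y ∉ ⟨ v ⟩ → Inv (y ∷ v)
    step {y = y} {v} (d′ , v′ , v′-ind , v′∈ , eq , A∩v′⊆v) y∈A y∉ =
      suc d′ , y ∷ v′ , independent-∷ v′ v′-ind (y∉ ∘ A∩v′⊆v y∈A) ,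
      (λ { zero → A⊆X y∈A ; (suc j) → v′∈ j }) , ≡.cong suc eq ,
      -- Removing the multiple of `y` from `z` leaves a vector that is still in `A` and lies in
      -- `⟨ v′ ⟩`, so the previous invariant applies to it.
      λ {z} z∈A (c , _ , z≈) → let rest = combination (tail c) v′
                                   rest≈ = x+y≈z⇒y≈z-x {y = rest} (≈ᴹ-sym z≈) in
        IsSubspace.resp-≈ᴹ yv-sub (≈ᴹ-sym z≈)
          (IsSubspace.+ᴹ-closed yv-sub (IsSubspace.*ₗ-closed yv-sub tt (∈-span (y ∷ v) zero))
            (span-tail (y ∷ v) (A∩v′⊆v
              (resp-≈ᴹ (≈ᴹ-sym rest≈) (+ᴹ-closed z∈A (*ₗ-closed tt (*ₗ-closed tt y∈A))))
              (tail c , _ , ≈ᴹ-refl))))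
      where
      open IsSubspace A-sub
      yv-sub = span-isSubspace (y ∷ v)

    extension = extend A-sub (dimension⇒∈? A-dim) (proj₁ (proj₂ (proj₂ A-dim))) Inv step
      i i-ind (λ j → proj₁ (proj₂ I≐ (∈-span i j)))
      (dB , proj₁ B-dim , proj₁ (proj₂ B-dim) ,
       (λ j → B⊆X (proj₂ (proj₂ (proj₂ B-dim)) (∈-span (proj₁ B-dim) j))) , ℕ.+-comm dI dB ,
       λ y∈A y∈b → proj₁ I≐ (y∈A , proj₂ (proj₂ (proj₂ B-dim)) y∈b))

  -- As many generators as the dimension are independent, so a vector lying in both spans would be a
  -- relation between the two halves of `xs ++ ys`.
  spanning⇒⊕ : {W : Pred Carrierᴹ w} → HasDimension W (d ℕ.+ e) →
    {xs : Vector Carrierᴹ d} {ys : Vector Carrierᴹ e} →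
    W SpannedBy (xs ++ ys) → W ≐ ⟨ xs ⟩ ⊕ ⟨ ys ⟩
  spanning⇒⊕ {d = d} {e} {W = W} W-dim {xs} {ys} W-span@(_ , W⊆) =
    (W⊆∔ , ∔⊆W) , ∩⊆0 , λ x≈0 →
      IsSubspace.resp-≈ᴹ xs-sub (≈ᴹ-sym x≈0) (IsSubspace.0ᴹ-closed xs-sub) ,
      IsSubspace.resp-≈ᴹ ys-sub (≈ᴹ-sym x≈0) (IsSubspace.0ᴹ-closed ys-sub)
    where
    xs-sub = span-isSubspace xs
    ys-sub = span-isSubspace ys
    W-sub = dimension⇒isSubspace W-dim

    W⊆∔ : W ⊆ ⟨ xs ⟩ ∔ ⟨ ys ⟩
    W⊆∔ x∈W with c , _ , x≈ ← W⊆ x∈W =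
      _ , _ , (_ , _ , ≈ᴹ-refl) , (_ , _ , ≈ᴹ-refl) , ≈ᴹ-trans x≈ (combination-++ c xs ys)

    ∔⊆W : ⟨ xs ⟩ ∔ ⟨ ys ⟩ ⊆ W
    ∔⊆W (y , z , y∈ , z∈ , x≈) = resp-≈ᴹ (≈ᴹ-sym x≈)
      (+ᴹ-closed (⟨xs++ys⟩⊆W (span-least xs++ys-sub (∈-span-++ˡ xs ys) y∈))
                 (⟨xs++ys⟩⊆W (span-least xs++ys-sub (∈-span-++ʳ xs ys) z∈)))
      where
      open IsSubspace W-sub
      xs++ys-sub = span-isSubspace (xs ++ ys)
      ⟨xs++ys⟩⊆W : ⟨ xs ++ ys ⟩ ⊆ W
      ⟨xs++ys⟩⊆W = proj₂ (spannedBy⇒≐ W-sub W-span)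

    ∩⊆0 : ⟨ xs ⟩ ∩ ⟨ ys ⟩ ⊆ zeroSubspace
    ∩⊆0 {x} ((α , _ , x≈α) , β , _ , x≈β) = begin
      x                       ≈⟨ x≈α ⟩
      combination α xs        ≈⟨ combination-cong α≈0 (λ _ → ≈ᴹ-refl) ⟩
      combination (λ _ → 0#) xs ≈⟨ combination-0 xs ⟩
      0ᴹ                      ∎
      where
      -- The coefficients of the relation `x - x = 0`, with `x` expanded once along `xs` and once
      -- along `ys`.
      γ : Vector Carrier (d ℕ.+ e)
      γ = α ++ (λ j → (- 1#) * β j)

      γˡ : ∀ i → γ (i ↑ˡ e) ≈ α i
      γˡ i rewrite Fin.splitAt-↑ˡ d i e = refl

      γʳ : ∀ j → γ (d ↑ʳ j) ≈ (- 1#) * β j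
      γʳ j rewrite Fin.splitAt-↑ʳ d e j = refl

      α≈0 : ∀ i → α i ≈ 0#
      α≈0 i = trans (sym (γˡ i)) (spanning⇒independent W-dim W-span γ _ (begin
        combination γ (xs ++ ys)
          ≈⟨ combination-++ γ xs ys ⟩
        combination (γ ∘ (_↑ˡ e)) xs +ᴹ combination (γ ∘ (d ↑ʳ_)) ys
          ≈⟨ +ᴹ-cong (combination-cong γˡ (λ _ → ≈ᴹ-refl)) (combination-cong γʳ (λ _ → ≈ᴹ-refl)) ⟩
        combination α xs +ᴹ combination (λ j → (- 1#) * β j) ys
          ≈⟨ +ᴹ-cong (≈ᴹ-sym x≈α) (≈ᴹ-trans (*-combination (- 1#) β ys) (*ₗ-congˡ (≈ᴹ-sym x≈β))) ⟩
        x +ᴹ (- 1#) *ₗ x ≈⟨ +ᴹ-congˡ (-1*x≈-x x) ⟩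
        x +ᴹ -ᴹ x        ≈⟨ -ᴹ‿inverseʳ x ⟩
        0ᴹ               ∎) (i ↑ˡ e))

-- Chains of a semilinear automorphism

-- Applying `f` innermost first makes entry `suc i` of `chain (τ x)` reduce to the i-th iterate at
-- `σ (τ x)`, which is entry i of `chain x` up to `στ`.
iterate : {A : Set a} → (A → A) → ℕ → A → A
iterate f zero    x = x
iterate f (suc i) x = iterate f i (f x)

module Chains
  {c ℓ₁ ℓ₂} (F : HeytingField c ℓ₁ ℓ₂) {N : ℕ} (finite : HasOrder F N)
  {m ℓm} (M : LeftModule (CommutativeRing.ring (HeytingCommutativeRing.commutativeRing
    (HeytingField.heytingCommutativeRing F))) m ℓm)
  (_≟ᴹ_ : B.Decidable (LeftModule._≈ᴹ_ M))
  where

  open HeytingCommutativeRing (HeytingField.heytingCommutativeRing F) using (commutativeRing)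
  open CommutativeRing commutativeRing hiding (zero)
  open LeftModule M
  open LinearAlgebra M U
  open FiniteFieldLinearAlgebra F finite M _≟ᴹ_
  open import Relation.Binary.Reasoning.Setoid ≈ᴹ-setoid

  record IsSemilinear (φ : Carrier → Carrier) (f : Carrierᴹ → Carrierᴹ) :
                      Set (c ⊔ m ⊔ ℓm) where
    field
      cong   : ∀ {x y} → x ≈ᴹ y → f x ≈ᴹ f y
      homo-+ : ∀ x y → f (x +ᴹ y) ≈ᴹ f x +ᴹ f y
      homo-* : ∀ a x → f (a *ₗ x) ≈ᴹ φ a *ₗ f x

    homo-0 : f 0ᴹ ≈ᴹ 0ᴹ
    homo-0 = begin
      f 0ᴹ                        ≈⟨ x+y≈z⇒y≈z-x (≈ᴹ-trans (≈ᴹ-sym (homo-+ 0ᴹ 0ᴹ)) (cong (+ᴹ-identityˡ 0ᴹ))) ⟩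
      f 0ᴹ +ᴹ (- 1#) *ₗ f 0ᴹ      ≈⟨ +ᴹ-congˡ (-1*x≈-x (f 0ᴹ)) ⟩
      f 0ᴹ +ᴹ -ᴹ f 0ᴹ             ≈⟨ -ᴹ‿inverseʳ (f 0ᴹ) ⟩
      0ᴹ                          ∎

    homo-combination : ∀ (c : Vector Carrier d) v →
      f (combination c v) ≈ᴹ combination (φ ∘ c) (f ∘ v)
    homo-combination {zero}  c v = homo-0
    homo-combination {suc d} c v = ≈ᴹ-trans (homo-+ _ _)
      (+ᴹ-cong (homo-* _ _) (homo-combination (tail c) (tail v)))

  module SemilinearAutomorphism
    (φ ψ : Carrier → Carrier) (ψ-injective : ∀ {a} → ψ a ≈ 0# → a ≈ 0#)
    (σ τ : Carrierᴹ → Carrierᴹ) (σ-semilinear : IsSemilinear φ σ) (τ-semilinear : IsSemilinear ψ τ)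
    (στ : ∀ x → σ (τ x) ≈ᴹ x) (τσ : ∀ x → τ (σ x) ≈ᴹ x)
    where

    private
      module σ = IsSemilinear σ-semilinear
      module τ = IsSemilinear τ-semilinear

    σⁱ-cong : ∀ i {x y} → x ≈ᴹ y → iterate σ i x ≈ᴹ iterate σ i y
    σⁱ-cong zero    x≈y = x≈y
    σⁱ-cong (suc i) x≈y = σⁱ-cong i (σ.cong x≈y)

    τσⁱ⁺¹ : ∀ i x → τ (iterate σ (suc i) x) ≈ᴹ iterate σ i x
    τσⁱ⁺¹ zero    x = τσ x
    τσⁱ⁺¹ (suc i) x = τσⁱ⁺¹ i (σ x)

    chain : Carrierᴹ → (d : ℕ) → Vector Carrierᴹ d
    chain x d i = iterate σ (toℕ i) x

    -- τ inverts σ, so this is the image σ W.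
    shift : Pred Carrierᴹ w → Pred Carrierᴹ w
    shift W x = τ x ∈ W

    core : Pred Carrierᴹ w → Pred Carrierᴹ w
    core W = W ∩ shift W

    shift-isSubspace : {W : Pred Carrierᴹ w} → IsSubspace W → IsSubspace (shift W)
    shift-isSubspace W-sub = record
      { resp-≈ᴹ   = λ x≈y → resp-≈ᴹ (τ.cong x≈y)
      ; 0ᴹ-closed = resp-≈ᴹ (≈ᴹ-sym τ.homo-0) 0ᴹ-closed
      ; +ᴹ-closed = λ x∈ y∈ → resp-≈ᴹ (≈ᴹ-sym (τ.homo-+ _ _)) (+ᴹ-closed x∈ y∈)
      ; *ₗ-closed = λ _ x∈ → resp-≈ᴹ (≈ᴹ-sym (τ.homo-* _ _)) (*ₗ-closed tt x∈)
      }
      where open IsSubspace W-sub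

    core-isSubspace : {W : Pred Carrierᴹ w} → IsSubspace W → IsSubspace (core W)
    core-isSubspace W-sub = record
      { resp-≈ᴹ   = λ x≈y (x∈ , x∈′) → W.resp-≈ᴹ x≈y x∈ , σW.resp-≈ᴹ x≈y x∈′
      ; 0ᴹ-closed = W.0ᴹ-closed , σW.0ᴹ-closed
      ; +ᴹ-closed = λ (x∈ , x∈′) (y∈ , y∈′) → W.+ᴹ-closed x∈ y∈ , σW.+ᴹ-closed x∈′ y∈′
      ; *ₗ-closed = λ _ (x∈ , x∈′) → W.*ₗ-closed tt x∈ , σW.*ₗ-closed tt x∈′
      }
      where
      module W = IsSubspace W-sub
      module σW = IsSubspace (shift-isSubspace W-sub)

    -- σ is only semilinear: a relation among the vectors `σ ∘ v` is pulled back with coefficients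
    -- changed by `ψ`, an expansion is pushed forward with coefficients changed by `φ`.
    shift-dimension : {W : Pred Carrierᴹ w} → HasDimension W d → HasDimension (shift W) d
    shift-dimension {W = W} W-dim@(v , v-ind , W≐) =
      σ ∘ v , σv-ind , σW⊆ , span-least (shift-isSubspace W-sub)
        (λ i → resp-≈ᴹ (≈ᴹ-sym (τσ (v i))) (proj₂ W≐ (∈-span v i)))
      where
      W-sub = dimension⇒isSubspace W-dim
      open IsSubspace W-sub

      σv-ind : LinearlyIndependent (σ ∘ v)
      σv-ind c _ cσv≈0 i = ψ-injective (v-ind (ψ ∘ c) _ (begin
        combination (ψ ∘ c) v             ≈⟨ combination-cong (λ _ → refl) (λ i → τσ (v i)) ⟨
        combination (ψ ∘ c) (τ ∘ σ ∘ v)   ≈⟨ τ.homo-combination c (σ ∘ v) ⟨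
        τ (combination c (σ ∘ v))         ≈⟨ τ.cong cσv≈0 ⟩
        τ 0ᴹ                              ≈⟨ τ.homo-0 ⟩
        0ᴹ                                ∎) i)

      σW⊆ : shift W ⊆ ⟨ σ ∘ v ⟩
      σW⊆ {x} τx∈W with c , _ , τx≈ ← proj₁ W≐ τx∈W = φ ∘ c , _ , (begin
        x                           ≈⟨ στ x ⟨
        σ (τ x)                     ≈⟨ σ.cong τx≈ ⟩
        σ (combination c v)         ≈⟨ σ.homo-combination c v ⟩
        combination (φ ∘ c) (σ ∘ v) ∎)

    core-hasDimension : {W : Pred Carrierᴹ w} → HasDimension W d → ∃[ e ] HasDimension (core W) e
    core-hasDimension W-dim = hasDimension (core-isSubspace (dimension⇒isSubspace W-dim))
      (λ x → dimension⇒∈? W-dim x ×-dec dimension⇒∈? W-dim (τ x))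
      (proj₁ (proj₂ (proj₂ W-dim)) ∘ proj₁)

    -- Both core W and its image under σ lie in σ W.
    core-dimension-convex : {W : Pred Carrierᴹ w} → ∀ {d₀ d₁ d₂} → HasDimension W d₀ →
      HasDimension (core W) d₁ → HasDimension (core (core W)) d₂ → d₁ ℕ.+ d₁ ℕ.≤ d₀ ℕ.+ d₂
    core-dimension-convex W-dim V-dim V₂-dim =
      dimension-∩ V-dim (shift-dimension V-dim) (shift-dimension W-dim) V₂-dim proj₂ proj₁

    -- Each entry after the first is σ of its predecessor, which is also in `V`. So modulo `core V`
    -- only the start of a chain survives.
    tail-chain∈core : {V : Pred Carrierᴹ w} → IsSubspace V → ∀ {x} →
      (∀ i → chain x (suc d) i ∈ V) → ∀ i → chain x (suc d) (suc i) ∈ core V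
    tail-chain∈core {d = d} {V = V} V-sub {x} x∈ i = x∈ (suc i) ,
      resp-≈ᴹ (≈ᴹ-sym (τσⁱ⁺¹ (toℕ i) x))
        (≡.subst (λ k → iterate σ k x ∈ V) (Fin.toℕ-inject₁ i) (x∈ (inject₁ i)))
      where open IsSubspace V-sub

    extend-chain : {W : Pred Carrierᴹ w} → IsSubspace W → ∀ {x} →
      (∀ i → chain x (suc d) i ∈ core W) → ∀ i → chain (τ x) (suc (suc d)) i ∈ W
    extend-chain W-sub x∈ zero    = proj₂ (x∈ zero)
    extend-chain W-sub x∈ (suc i) =
      IsSubspace.resp-≈ᴹ W-sub (σⁱ-cong (toℕ i) (≈ᴹ-sym (στ _))) (proj₁ (x∈ i))

    chain∈extended-chain : {W : Pred Carrierᴹ w} → IsSubspace W → ∀ {x} →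
      (∀ i → chain (τ x) (suc d) i ∈ W) → ∀ i → chain x d i ∈ W
    chain∈extended-chain W-sub τx∈ i =
      IsSubspace.resp-≈ᴹ W-sub (σⁱ-cong (toℕ i) (στ _)) (τx∈ (suc i))

    -- `no-orbit` is the form in which the absence of rank one elements reaches the dimension
    -- arguments.
    module _ {C : Pred Carrierᴹ w} (no-orbit : ∀ {x} → (∀ t → iterate τ t x ∈ C) → x ≈ᴹ 0ᴹ) where

      -- `V ⊆ shift V` says that τ maps `V` into itself. Orbits of its vectors then never leave `C`,
      -- so all these vectors are zero and the empty family spans `V`.
      no-invariant : {V : Pred Carrierᴹ w} → HasDimension V (suc d) → V ⊆ C → V ⊆ shift V → ⊥
      no-invariant {V = V} V-dim V⊆C V⊆σV = ℕ.1+n≰n (ℕ.≤-trans (dimension≤ V-dim {u = []}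
          λ x∈V → (λ ()) , _ , no-orbit (λ t → V⊆C (orbit∈V t x∈V))) z≤n)
        where
        orbit∈V : ∀ t {x} → x ∈ V → iterate τ t x ∈ V
        orbit∈V zero    x∈V = x∈V
        orbit∈V (suc t) x∈V = orbit∈V t (V⊆σV x∈V)

      core-proper : {V : Pred Carrierᴹ w} → HasDimension V (suc d) → V ⊆ C →
        HasDimension (core V) e → e ℕ.< suc d
      core-proper {V = V} V-dim V⊆C V₂-dim = ℕ.≤∧≢⇒< (dimension-⊆ V₂-dim V-dim proj₁)
        λ { ≡.refl → no-invariant V-dim V⊆C
              (λ x∈V → proj₂ (dimension-≡⇒⊇ V₂-dim V-dim proj₁ x∈V)) }

      -- Once the drop is one it stays one: properness of the core bounds `e` from above, convexity
      -- of the dimensions bounds it from below.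
      core-drop : {W : Pred Carrierᴹ w} → HasDimension W (suc (suc d)) → W ⊆ C →
        HasDimension (core W) (suc d) → HasDimension (core (core W)) e → e ≡ d
      core-drop {d = d} {e} W-dim W⊆C V-dim V₂-dim =
        ℕ.≤-antisym (ℕ.s≤s⁻¹ (core-proper V-dim (W⊆C ∘ proj₁) V₂-dim))
          (ℕ.+-cancelˡ-≤ (suc (suc d)) d e
            (≡.subst (ℕ._≤ suc (suc d) ℕ.+ e) (≡.cong suc (ℕ.+-suc d d))
              (core-dimension-convex W-dim V-dim V₂-dim)))

      core-drop₂ : {W : Pred Carrierᴹ w} → HasDimension W (suc (suc (suc (suc d)))) →
        HasDimension (core W) (suc (suc d)) → HasDimension (core (core W)) e → d ℕ.≤ e
      core-drop₂ {d = d} {e} W-dim V-dim V₂-dim =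
        ℕ.+-cancelˡ-≤ (4 ℕ.+ d) d e
          (≡.subst (ℕ._≤ 4 ℕ.+ d ℕ.+ e)
            (≡.cong (2 ℕ.+_) (≡.trans (ℕ.+-suc d (suc d)) (≡.cong suc (ℕ.+-suc d d))))
            (core-dimension-convex W-dim V-dim V₂-dim))

      -- τ sends every later entry of the chain to its predecessor. If it also sent the start into
      -- `core W`, then all of `core W` would be τ-stable, against `no-invariant`.
      chain-start∉core : {W : Pred Carrierᴹ w} → IsSubspace W → W ⊆ C → HasDimension (core W) (suc d) → ∀ {x} →
        core W SpannedBy chain x (suc d) → τ x ∉ core W
      chain-start∉core {d = d} W-sub W⊆C V-dim {x} (x∈V , V⊆) τx∈V = no-invariant V-dim (W⊆C ∘ proj₁)
        (span-least (shift-isSubspace V-sub) {chain x (suc d)}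
          (λ { zero → τx∈V ; (suc i) → proj₂ (tail-chain∈core V-sub x∈V i) }) ∘ V⊆)
        where V-sub = core-isSubspace W-sub

      -- Since the drop is one, `τ x` together with a basis of `core W` is already a basis of `W`.
      chain-extends : {W : Pred Carrierᴹ w} → HasDimension W (suc (suc d)) → W ⊆ C →
        HasDimension (core W) (suc d) → ∀ {x} → core W SpannedBy chain x (suc d) →
        W SpannedBy chain (τ x) (suc (suc d))
      chain-extends {d = d} {W = W} W-dim W⊆C V-dim@(v , v-ind , V≐) {x} V-span@(x∈V , V⊆) =
        τx∈W , span-least chain-sub {τ x ∷ v} v∈ ∘ independent-spans W-dim τxv-ind v∈W
        where
        W-sub = dimension⇒isSubspace W-dim
        chain-sub = span-isSubspace (chain (τ x) (suc (suc d)))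

        τx∈W : ∀ i → chain (τ x) (suc (suc d)) i ∈ W
        τx∈W = extend-chain W-sub x∈V

        τxv-ind : LinearlyIndependent (τ x ∷ v)
        τxv-ind = independent-∷ v v-ind (chain-start∉core W-sub W⊆C V-dim V-span ∘ proj₂ V≐)

        v∈W : ∀ i → (τ x ∷ v) i ∈ W
        v∈W zero    = τx∈W zero
        v∈W (suc i) = proj₁ (proj₂ V≐ (∈-span v i))

        v∈ : ∀ i → (τ x ∷ v) i ∈ ⟨ chain (τ x) (suc (suc d)) ⟩
        v∈ zero    = ∈-span (chain (τ x) (suc (suc d))) zero
        v∈ (suc i) = span-least chain-sub {chain x (suc d)}
          (chain∈extended-chain chain-sub (∈-span (chain (τ x) (suc (suc d)))))
          (V⊆ (proj₂ V≐ (∈-span v i)))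

      one-chain : ∀ e {W : Pred Carrierᴹ w} → HasDimension W (suc e) → W ⊆ C →
        HasDimension (core W) e → ∃[ x ] W SpannedBy chain x (suc e)
      one-chain zero W-dim@(v , v-ind , W≐) W⊆C _ = v zero ,
        (λ { zero → proj₂ W≐ (∈-span v zero) }) ,
        span-least (span-isSubspace (chain (v zero) 1)) {v} (λ { zero → ∈-span (chain (v zero) 1) zero }) ∘ proj₁ W≐
      one-chain (suc e) {W} W-dim W⊆C V-dim =
        let e₂ , V₂-dim = core-hasDimension V-dim
            x , V-span  = one-chain e V-dim (W⊆C ∘ proj₁)
              (≡.subst (HasDimension (core (core W))) (core-drop W-dim W⊆C V-dim V₂-dim) V₂-dim)
        in τ x , chain-extends W-dim W⊆C V-dim V-span

      module _ {W : Pred Carrierᴹ w} (W-dim : HasDimension W (suc (suc d))) (W⊆C : W ⊆ C) where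
        private
          V = core W
          W-sub = dimension⇒isSubspace W-dim
          V-sub = core-isSubspace W-sub

        -- With a drop of two, `τ x` supplies one of the missing dimensions and any further vector
        -- `y` the other. The condition `d ≡ suc e` makes the chain nonempty, so that `x` lies in
        -- `core W` and `τ x` in `W`. Writing `y` as `chain y 1` lets the result count as two
        -- chains.
        chain-and-vector : ∀ {e} → d ≡ suc e → HasDimension V d → ∀ {x} → V SpannedBy chain x d →
          ∃[ y ] W SpannedBy (chain (τ x) (suc d) ++ chain y 1)
        chain-and-vector {e} ≡.refl V-dim@(v , v-ind , V≐) {x} V-span@(x∈V , V⊆) =
          y , ++-all W xs ys τx∈W (λ { zero → y∈W }) ,
          span-least gens-sub {y ∷ (τ x ∷ v)} v∈ ∘ independent-spans W-dim yτxv-ind v∈W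
          where
          τx∈W : ∀ i → chain (τ x) (suc (suc e)) i ∈ W
          τx∈W = extend-chain W-sub x∈V

          outside = exists-outside W-dim ℕ.≤-refl (τ x ∷ v)
          y = proj₁ outside

          y∈W : y ∈ W
          y∈W = proj₁ (proj₂ outside)

          xs = chain (τ x) (suc (suc e))
          ys = chain y 1
          gens-sub = span-isSubspace (xs ++ ys)

          yτxv-ind : LinearlyIndependent (y ∷ (τ x ∷ v))
          yτxv-ind = independent-∷ (τ x ∷ v)
            (independent-∷ v v-ind (chain-start∉core W-sub W⊆C V-dim V-span ∘ proj₂ V≐))
            (proj₂ (proj₂ outside))

          v∈W : ∀ i → (y ∷ (τ x ∷ v)) i ∈ W
          v∈W zero          = y∈W
          v∈W (suc zero)    = τx∈W zero
          v∈W (suc (suc i)) = proj₁ (proj₂ V≐ (∈-span v i))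

          v∈ : ∀ i → (y ∷ (τ x ∷ v)) i ∈ ⟨ xs ++ ys ⟩
          v∈ zero          = ∈-span-++ʳ xs ys zero
          v∈ (suc zero)    = ∈-span-++ˡ xs ys zero
          v∈ (suc (suc i)) = span-least gens-sub {chain x (suc e)}
            (chain∈extended-chain gens-sub (∈-span-++ˡ xs ys)) (V⊆ (proj₂ V≐ (∈-span v i)))

        -- The bound `suc e < d` says that `core V` has codimension at least two in `V`, so neither
        -- of `x` and `y` is redundant modulo `core V`. If `τ x` were in `V`, then `x` would be in
        -- `core V`; `τ y` is treated by applying σ.
        two-chains-extend : ∀ {i j} → HasDimension V d → HasDimension (core V) e → suc e ℕ.< d →
          ∀ {x y} → V SpannedBy (chain x (suc i) ++ chain y (suc j)) →
          W SpannedBy (chain (τ x) (suc (suc i)) ++ chain (τ y) (suc (suc j)))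
        two-chains-extend {i = i} {j} V-dim@(v , v-ind , V≐) (v₂ , v₂-ind , V₂≐) 1+e<d {x} {y} (xy∈V , V⊆) =
          ++-all W xs ys τx∈W τy∈W ,
          span-least gens-sub {τ y ∷ (τ x ∷ v)} v∈ ∘ independent-spans W-dim τyτxv-ind v∈W
          where
          xs = chain (τ x) (suc (suc i))
          ys = chain (τ y) (suc (suc j))
          gens-sub = span-isSubspace (xs ++ ys)

          x∈V : ∀ k → chain x (suc i) k ∈ V
          x∈V k = span-least V-sub xy∈V (∈-span-++ˡ (chain x (suc i)) (chain y (suc j)) k)

          y∈V : ∀ k → chain y (suc j) k ∈ V
          y∈V k = span-least V-sub xy∈V (∈-span-++ʳ (chain x (suc i)) (chain y (suc j)) k)

          τx∈W : ∀ k → xs k ∈ W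
          τx∈W = extend-chain W-sub x∈V

          τy∈W : ∀ k → ys k ∈ W
          τy∈W = extend-chain W-sub y∈V

          -- Modulo core V, the space V is spanned by x and y and has
          -- dimension at least two.
          not-spanned : ∀ z → x ∈ ⟨ z ∷ v₂ ⟩ → y ∈ ⟨ z ∷ v₂ ⟩ → ⊥
          not-spanned z x∈ y∈ = ℕ.<⇒≱ 1+e<d (dimension≤ V-dim {u = z ∷ v₂}
            (span-least (span-isSubspace (z ∷ v₂)) {chain x (suc i) ++ chain y (suc j)}
              (++-all ⟨ z ∷ v₂ ⟩ (chain x (suc i)) (chain y (suc j)) xs∈ ys∈) ∘ V⊆))
            where
            xs∈ : ∀ k → chain x (suc i) k ∈ ⟨ z ∷ v₂ ⟩
            xs∈ zero    = x∈
            xs∈ (suc k) = span-tail (z ∷ v₂) (proj₁ V₂≐ (tail-chain∈core V-sub x∈V k))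

            ys∈ : ∀ k → chain y (suc j) k ∈ ⟨ z ∷ v₂ ⟩
            ys∈ zero    = y∈
            ys∈ (suc k) = span-tail (z ∷ v₂) (proj₁ V₂≐ (tail-chain∈core V-sub y∈V k))

          τx∉V : τ x ∉ V
          τx∉V τx∈V = not-spanned y (span-tail (y ∷ v₂) (proj₁ V₂≐ (x∈V zero , τx∈V)))
                        (∈-span (y ∷ v₂) zero)

          -- σ turns the supposed expansion of `τ y` into `y` being a multiple of `x` plus `σ r`
          -- with `r` in `V`. The remainder `σ r` is in `V` as well, since `x` and `y` are, so it
          -- lies in `core V`, and `x` alone would generate `V` modulo `core V`.
          τy∉ : τ y ∉ ⟨ τ x ∷ v ⟩
          τy∉ (c , _ , τy≈) = not-spanned x (∈-span (x ∷ v₂) zero)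
            (resp-≈ᴹ (≈ᴹ-sym y≈) (+ᴹ-closed (*ₗ-closed tt (∈-span (x ∷ v₂) zero))
              (span-tail (x ∷ v₂) (proj₁ V₂≐ (σr∈V , τσr∈V)))))
            where
            open IsSubspace (span-isSubspace (x ∷ v₂))
            module V = IsSubspace V-sub

            r : Carrierᴹ
            r = combination (tail c) v

            y≈ : y ≈ᴹ φ (c zero) *ₗ x +ᴹ σ r
            y≈ = begin
              y                                     ≈⟨ στ y ⟨
              σ (τ y)                               ≈⟨ σ.cong τy≈ ⟩
              σ (c zero *ₗ τ x +ᴹ r)                ≈⟨ σ.homo-+ _ _ ⟩
              σ (c zero *ₗ τ x) +ᴹ σ r              ≈⟨ +ᴹ-congʳ (σ.homo-* _ _) ⟩
              φ (c zero) *ₗ σ (τ x) +ᴹ σ r          ≈⟨ +ᴹ-congʳ (*ₗ-congˡ (στ x)) ⟩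
              φ (c zero) *ₗ x +ᴹ σ r                ∎

            τσr∈V : τ (σ r) ∈ V
            τσr∈V = V.resp-≈ᴹ (≈ᴹ-sym (τσ r)) (proj₂ V≐ (tail c , _ , ≈ᴹ-refl))

            σr∈V : σ r ∈ V
            σr∈V = V.resp-≈ᴹ (≈ᴹ-sym (x+y≈z⇒y≈z-x (≈ᴹ-sym y≈)))
              (V.+ᴹ-closed (y∈V zero) (V.*ₗ-closed tt (V.*ₗ-closed tt (x∈V zero))))

          τyτxv-ind : LinearlyIndependent (τ y ∷ (τ x ∷ v))
          τyτxv-ind = independent-∷ (τ x ∷ v) (independent-∷ v v-ind (τx∉V ∘ proj₂ V≐)) τy∉

          v∈W : ∀ k → (τ y ∷ (τ x ∷ v)) k ∈ W
          v∈W zero          = τy∈W zero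
          v∈W (suc zero)    = τx∈W zero
          v∈W (suc (suc k)) = proj₁ (proj₂ V≐ (∈-span v k))

          v∈ : ∀ k → (τ y ∷ (τ x ∷ v)) k ∈ ⟨ xs ++ ys ⟩
          v∈ zero          = ∈-span-++ʳ xs ys zero
          v∈ (suc zero)    = ∈-span-++ˡ xs ys zero
          v∈ (suc (suc k)) = span-least gens-sub {chain x (suc i) ++ chain y (suc j)}
            (++-all ⟨ xs ++ ys ⟩ (chain x (suc i)) (chain y (suc j))
                    (chain∈extended-chain gens-sub (∈-span-++ˡ xs ys))
                    (chain∈extended-chain gens-sub (∈-span-++ʳ xs ys)))
            (V⊆ (proj₂ V≐ (∈-span v k)))

      -- The lengths are successors because only a nonempty chain in a core can be started one step
      -- earlier.
      SpannedByTwoChains : Pred Carrierᴹ w → ℕ → Set _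
      SpannedByTwoChains W d = ∃₂ λ x y → ∃₂ λ i j → suc i ℕ.+ suc j ≡ d ×
        W SpannedBy (chain x (suc i) ++ chain y (suc j))

      two-chains : ∀ e {W : Pred Carrierᴹ w} → HasDimension W (suc (suc e)) → W ⊆ C →
        HasDimension (core W) e → SpannedByTwoChains W (suc (suc e))
      two-chains zero {W} W-dim@(v , v-ind , W≐) W⊆C _ =
        v zero , v (suc zero) , 0 , 0 , ≡.refl ,
        ++-all W xs ys (λ { zero → proj₂ W≐ (∈-span v zero) }) (λ { zero → proj₂ W≐ (∈-span v (suc zero)) }) ,
        span-least (span-isSubspace (xs ++ ys)) {v}
          (λ { zero → ∈-span-++ˡ xs ys zero ; (suc zero) → ∈-span-++ʳ xs ys zero })
        ∘ proj₁ W≐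
        where
        xs = chain (v zero) 1
        ys = chain (v (suc zero)) 1
      -- Here `core W` is a line and properness makes its core zero, so the drop has just passed
      -- from one to two.
      two-chains (suc zero) W-dim W⊆C V-dim =
        let e₂ , V₂-dim = core-hasDimension V-dim
            e₂≡0        = ℕ.n≤0⇒n≡0 (ℕ.s≤s⁻¹ (core-proper V-dim (W⊆C ∘ proj₁) V₂-dim))
            x , V-span  = one-chain 0 V-dim (W⊆C ∘ proj₁) (≡.subst (HasDimension _) e₂≡0 V₂-dim)
            y , W-span  = chain-and-vector W-dim W⊆C ≡.refl V-dim V-span
        in τ x , y , 1 , 0 , ≡.refl , W-span
      two-chains (suc (suc e)) {W} W-dim W⊆C V-dim =
        let e₂ , V₂-dim = core-hasDimension V-dim in
        -- The next drop is at least one. Equality in the bound means one; otherwise `core-drop₂`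
        -- leaves only two, and the recursion applies.
        by-drop V₂-dim (ℕ.m≤n⇒m<n∨m≡n (ℕ.s≤s⁻¹ (core-proper V-dim (W⊆C ∘ proj₁) V₂-dim)))
        where
        by-drop : ∀ {e₂} → HasDimension (core (core W)) e₂ → e₂ ℕ.< suc e ⊎ e₂ ≡ suc e →
          SpannedByTwoChains W (4 ℕ.+ e)
        by-drop V₂-dim (inj₂ ≡.refl) =
          let x , V-span = one-chain (suc e) V-dim (W⊆C ∘ proj₁) V₂-dim
              y , W-span = chain-and-vector W-dim W⊆C ≡.refl V-dim V-span
          in τ x , y , suc (suc e) , 0 , ≡.cong suc (ℕ.+-comm (suc (suc e)) 1) , W-span
        by-drop V₂-dim (inj₁ e₂<1+e) =
          let e₂≡e = ℕ.≤-antisym (ℕ.s≤s⁻¹ e₂<1+e) (core-drop₂ W-dim V-dim V₂-dim)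
              x , y , i , j , i+j≡ , V-span = two-chains e V-dim (W⊆C ∘ proj₁)
                (≡.subst (HasDimension (core (core W))) e₂≡e V₂-dim)
          in τ x , τ y , suc i , suc j , ≡.cong (2 ℕ.+_) (≡.trans (ℕ.+-suc i (suc j)) i+j≡) ,
             two-chains-extend W-dim W⊆C V-dim V₂-dim (s≤s e₂<1+e) V-span

-- Congruences modulo n

module Congruence (n : ℕ) where

  open ≡ using (refl; sym; trans; cong; subst; module ≡-Reasoning)

  infix 4 _≋_

  -- The equation is solved for `i`, so that matching it with `refl` eliminates `i` and leaves ring
  -- identities to prove.
  record _≋_ (i j : ℤ) : Set where
    constructor differ-by
    field
      multiple : ℤ
      equation : i ≡ j ℤ.+ multiple ℤ.* + n

  ≋-reflexive : ∀ {i j} → i ≡ j → i ≋ j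
  ≋-reflexive {i} refl = differ-by (+ 0) (lemma i (+ n))
    where
    lemma : ∀ i m → i ≡ i ℤ.+ + 0 ℤ.* m
    lemma = solve-∀

  ≋-sym : ∀ {i j} → i ≋ j → j ≋ i
  ≋-sym {i} {j} (differ-by k i≡) =
    differ-by (ℤ.- k) (trans (lemma j k (+ n)) (cong (ℤ._+ (ℤ.- k) ℤ.* + n) (sym i≡)))
    where
    lemma : ∀ j k m → j ≡ j ℤ.+ k ℤ.* m ℤ.+ (ℤ.- k) ℤ.* m
    lemma = solve-∀

  ≋-trans : ∀ {i j k} → i ≋ j → j ≋ k → i ≋ k
  ≋-trans {k = k} (differ-by a refl) (differ-by b refl) = differ-by (a ℤ.+ b) (lemma k a b (+ n))
    where
    lemma : ∀ k a b m → k ℤ.+ b ℤ.* m ℤ.+ a ℤ.* m ≡ k ℤ.+ (a ℤ.+ b) ℤ.* m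
    lemma = solve-∀

  ≋-+ : ∀ {i j k l} → i ≋ j → k ≋ l → i ℤ.+ k ≋ j ℤ.+ l
  ≋-+ {j = j} {l = l} (differ-by a refl) (differ-by b refl) = differ-by (a ℤ.+ b) (lemma j l a b (+ n))
    where
    lemma : ∀ j l a b m → j ℤ.+ a ℤ.* m ℤ.+ (l ℤ.+ b ℤ.* m) ≡ j ℤ.+ l ℤ.+ (a ℤ.+ b) ℤ.* m
    lemma = solve-∀

  ≋-*ˡ : ∀ k {i j} → i ≋ j → k ℤ.* i ≋ k ℤ.* j
  ≋-*ˡ k {j = j} (differ-by a refl) = differ-by (k ℤ.* a) (lemma k j a (+ n))
    where
    lemma : ∀ k j a m → k ℤ.* (j ℤ.+ a ℤ.* m) ≡ k ℤ.* j ℤ.+ k ℤ.* a ℤ.* m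
    lemma = solve-∀

  ≋-neg : ∀ {i j} → i ≋ j → ℤ.- i ≋ ℤ.- j
  ≋-neg {j = j} (differ-by a refl) = differ-by (ℤ.- a) (lemma j a (+ n))
    where
    lemma : ∀ j a m → ℤ.- (j ℤ.+ a ℤ.* m) ≡ ℤ.- j ℤ.+ (ℤ.- a) ℤ.* m
    lemma = solve-∀

  ∣s∣≡±s : ∀ s → ∃[ ε ] + ∣ s ∣ ≡ ε ℤ.* s
  ∣s∣≡±s (+ m)    = + 1 , sym (ℤ.*-identityˡ (+ m))
  ∣s∣≡±s -[1+ m ] = -[1+ 0 ] , sym (ℤ.-1*i≡-i -[1+ m ])

  -- `u` is the Bézout coefficient of `∣ s ∣` times the sign `ε` of `s`; it is negated when the
  -- identity over the naturals reads 1 + x ∣ s ∣ = y n.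
  gcd≡1⇒invertible : ∀ s → gcd s (+ n) ≡ + 1 → ∃[ u ] u ℤ.* s ≋ + 1
  gcd≡1⇒invertible s gcd≡1 with ε , ∣s∣≡ ← ∣s∣≡±s s
    with subst (λ d → Bézout.Identity d ∣ s ∣ n) (ℤ.+-injective gcd≡1) (Bézout.identity (gcd-GCD ∣ s ∣ n))
  ... | Bézout.+- x y 1+yn≡x∣s∣ = + x ℤ.* ε , differ-by (+ y) (begin
    + x ℤ.* ε ℤ.* s       ≡⟨ ℤ.*-assoc (+ x) ε s ⟩
    + x ℤ.* (ε ℤ.* s)     ≡⟨ cong (+ x ℤ.*_) ∣s∣≡ ⟨
    + x ℤ.* + ∣ s ∣       ≡⟨ ℤ.pos-* x ∣ s ∣ ⟨
    + (x ℕ.* ∣ s ∣)       ≡⟨ cong +_ 1+yn≡x∣s∣ ⟨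
    + 1 ℤ.+ + (y ℕ.* n)   ≡⟨ cong (ℤ._+_ (+ 1)) (ℤ.pos-* y n) ⟩
    + 1 ℤ.+ + y ℤ.* + n   ∎)
    where open ≡-Reasoning
  ... | Bézout.-+ x y 1+x∣s∣≡yn = ℤ.- (+ x ℤ.* ε) , differ-by (ℤ.- (+ y)) (begin
    ℤ.- (+ x ℤ.* ε) ℤ.* s                 ≡⟨ lemma (+ x) ε s ⟩
    + 1 ℤ.- (+ 1 ℤ.+ + x ℤ.* (ε ℤ.* s))   ≡⟨ cong (λ t → + 1 ℤ.- (+ 1 ℤ.+ + x ℤ.* t)) ∣s∣≡ ⟨
    + 1 ℤ.- (+ 1 ℤ.+ + x ℤ.* + ∣ s ∣)     ≡⟨ cong (λ t → + 1 ℤ.- (+ 1 ℤ.+ t)) (ℤ.pos-* x ∣ s ∣) ⟨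
    + 1 ℤ.- + (1 ℕ.+ x ℕ.* ∣ s ∣)         ≡⟨ cong (λ t → + 1 ℤ.- + t) 1+x∣s∣≡yn ⟩
    + 1 ℤ.- + (y ℕ.* n)                   ≡⟨ cong (ℤ._-_ (+ 1)) (ℤ.pos-* y n) ⟩
    + 1 ℤ.- + y ℤ.* + n                   ≡⟨ cong (ℤ._+_ (+ 1)) (ℤ.neg-distribˡ-* (+ y) (+ n)) ⟩
    + 1 ℤ.+ (ℤ.- + y) ℤ.* + n             ∎)
    where
    open ≡-Reasoning
    lemma : ∀ x ε s → ℤ.- (x ℤ.* ε) ℤ.* s ≡ + 1 ℤ.- (+ 1 ℤ.+ x ℤ.* (ε ℤ.* s))
    lemma = solve-∀

  module _ .{{_ : NonZero n}} where

    %ℕ-≋ : ∀ i → + (i %ℕ n) ≋ i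
    %ℕ-≋ i = ≋-sym (differ-by (i ℤ./ℕ n) (a≡a%ℕn+[a/ℕn]*n i n))

    ≋⇒≡ : ∀ {i j} → i ℕ.< n → j ℕ.< n → + i ≋ + j → i ≡ j
    ≋⇒≡ {i} {j} i<n j<n (differ-by (+ k) i≡) = begin
      i                   ≡⟨ m<n⇒m%n≡m i<n ⟨
      i % n               ≡⟨ cong (_% n) (ℤ.+-injective (trans i≡ (cong (ℤ._+_ (+ j)) (sym (ℤ.pos-* k n))))) ⟩
      (j ℕ.+ k ℕ.* n) % n ≡⟨ [m+kn]%n≡m%n j k n ⟩
      j % n               ≡⟨ m<n⇒m%n≡m j<n ⟩
      j                   ∎
      where open ≡-Reasoning
    ≋⇒≡ {i} {j} i<n j<n i≋j@(differ-by -[1+ k ] _) =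
      sym (≋⇒≡ j<n i<n (differ-by (+ suc k) (_≋_.equation (≋-sym i≋j))))

    %ℕ-cong : ∀ {i j} → i ≋ j → i %ℕ n ≡ j %ℕ n
    %ℕ-cong {i} {j} i≋j = ≋⇒≡ (n%ℕd<d i n) (n%ℕd<d j n) (≋-trans (%ℕ-≋ i) (≋-trans i≋j (≋-sym (%ℕ-≋ j))))

    toℕ-%ℕ : ∀ (i : Fin n) → + toℕ i %ℕ n ≡ toℕ i
    toℕ-%ℕ i = m<n⇒m%n≡m (Fin.toℕ<n i)

    residue : ℤ → Fin n
    residue i = fromℕ< (n%ℕd<d i n)

    toℕ-residue : ∀ i → + toℕ (residue i) ≋ i
    toℕ-residue i = ≋-trans (≋-reflexive (cong +_ (Fin.toℕ-fromℕ< (n%ℕd<d i n)))) (%ℕ-≋ i)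

    residue-cong : ∀ {i j} → i ≋ j → residue i ≡ residue j
    residue-cong {i} {j} i≋j = Fin.fromℕ<-cong _ _ (%ℕ-cong i≋j) (n%ℕd<d i n) (n%ℕd<d j n)

    residue-toℕ : ∀ i → residue (+ toℕ i) ≡ i
    residue-toℕ i = Fin.toℕ-injective (trans (Fin.toℕ-fromℕ< (n%ℕd<d (+ toℕ i) n)) (toℕ-%ℕ i))

    rotation : ℤ → Permutation′ n
    rotation k = permutation (λ i → residue (+ toℕ i ℤ.+ k)) (λ i → residue (+ toℕ i ℤ.- k))
      (λ i → trans (residue-cong (≋-trans (≋-+ (toℕ-residue (+ toℕ i ℤ.- k)) (≋-reflexive refl))
               (≋-reflexive (lemma₁ (+ toℕ i) k)))) (residue-toℕ i))
      (λ i → trans (residue-cong (≋-trans (≋-+ (toℕ-residue (+ toℕ i ℤ.+ k)) (≋-reflexive refl))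
               (≋-reflexive (lemma₂ (+ toℕ i) k)))) (residue-toℕ i))
      where
      lemma₁ : ∀ i k → i ℤ.- k ℤ.+ k ≡ i
      lemma₁ = solve-∀
      lemma₂ : ∀ i k → i ℤ.+ k ℤ.- k ≡ i
      lemma₂ = solve-∀

-- The Frobenius action on linearized polynomials

module FrobeniusAction
  {c ℓ₁ ℓ₂} (F : HeytingField c ℓ₁ ℓ₂) (q : ℕ) (q-primePower : IsPrimePower q)
  (n : ℕ) .{{_ : NonZero n}} (finite : HasOrder F (q ℕ.^ n))
  where

  open HeytingCommutativeRing (HeytingField.heytingCommutativeRing F) using (commutativeRing)
  open CommutativeRing commutativeRing hiding (zero)
  open FiniteField F finite
  open FiniteFieldArithmetic F finite
  open FiniteFieldCharacters F finite
  open LinearizedPolynomials F q n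
  open LeftModule 𝓛-leftModule using (_+ᴹ_; _*ₗ_; 0ᴹ)
  open Congruence n
  open Exp commutativeSemiring
  open SemiringSum semiring
  open import Relation.Binary.Reasoning.Setoid setoid

  private
    char degree : ℕ
    char   = proj₁ q-primePower
    degree = proj₁ (proj₂ q-primePower)

    char-prime : Prime char
    char-prime = proj₁ (proj₂ (proj₂ q-primePower))

    q^m≡char^ : ∀ m → q ℕ.^ m ≡ char ℕ.^ (degree ℕ.* m)
    q^m≡char^ m = ≡.trans (≡.cong (ℕ._^ m) (proj₂ (proj₂ (proj₂ (proj₂ q-primePower))))) (ℕ.^-*-assoc char degree m)

  _≟ᴹ_ : B.Decidable _≈ᴹ_
  f ≟ᴹ g = Fin.all? (λ i → f i ≟ g i)

  open FiniteFieldLinearAlgebra F finite 𝓛-leftModule _≟ᴹ_ using (combination-∈)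
  open Characteristic char-prime {degree ℕ.* n} (q^m≡char^ n)

  1<q : 1 ℕ.< q
  1<q = ℕ.≰⇒> λ q≤1 → ℕ.<⇒≱ 1<N (ℕ.≤-trans (ℕ.^-monoˡ-≤ n q≤1) (ℕ.≤-reflexive (ℕ.^-zeroˡ n)))

  ^q^-distrib-+ : ∀ m x y → (x + y) ^ (q ℕ.^ m) ≈ x ^ (q ℕ.^ m) + y ^ (q ℕ.^ m)
  ^q^-distrib-+ m x y rewrite q^m≡char^ m = ^p^m-distrib-+ (degree ℕ.* m) x y

  1^m≈1 : ∀ m → 1# ^ m ≈ 1#
  1^m≈1 zero    = refl
  1^m≈1 (suc m) = trans (*-identityˡ _) (1^m≈1 m)

  0^q^ : ∀ m → 0# ^ (q ℕ.^ m) ≈ 0#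
  0^q^ m = decidable-stable (_ ≟ 0#) λ 0^q^m≉0 → 0^q^m≉0 (zero-power (q ℕ.^ m) (ℕ.m^n>0 q m))
    where
    instance _ = ℕ.>-nonZero (ℕ.<-trans (s≤s z≤n) 1<q)
    zero-power : ∀ k → 0 ℕ.< k → 0# ^ k ≈ 0#
    zero-power (suc k) _ = zeroˡ (0# ^ k)

  ^q^-sum : ∀ m (t : Vector Carrier d) → sum t ^ (q ℕ.^ m) ≈ sum (λ i → t i ^ (q ℕ.^ m))
  ^q^-sum {zero}  m t = 0^q^ m
  ^q^-sum {suc d} m t = trans (^q^-distrib-+ m _ _) (+-congˡ (^q^-sum m (tail t)))

  x^N^k≈x : ∀ k x → x ^ ((q ℕ.^ n) ℕ.^ k) ≈ x
  x^N^k≈x zero    x = *-identityʳ x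
  x^N^k≈x (suc k) x = begin
    x ^ (q ℕ.^ n ℕ.* (q ℕ.^ n) ℕ.^ k)  ≈⟨ ^-assocʳ x (q ℕ.^ n) _ ⟨
    (x ^ (q ℕ.^ n)) ^ ((q ℕ.^ n) ℕ.^ k) ≈⟨ x^N^k≈x k _ ⟩
    x ^ (q ℕ.^ n)                      ≈⟨ x^N≈x x ⟩
    x                                  ∎

  -- Exponents of q may be reduced modulo n because raising to the power `q ^ n`, the order of the
  -- field, fixes every element.
  frobenius-+ℕ : ∀ m x → frobenius (+ m) x ≈ x ^ (q ℕ.^ m)
  frobenius-+ℕ m x = sym (begin
    x ^ (q ℕ.^ m)
      ≈⟨ ^-congʳ x (≡.cong (q ℕ.^_) (m≡m%n+[m/n]*n m n)) ⟩
    x ^ (q ℕ.^ (m % n ℕ.+ m / n ℕ.* n))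
      ≈⟨ ^-congʳ x (≡.trans (ℕ.^-distribˡ-+-* q (m % n) (m / n ℕ.* n))
           (≡.cong (q ℕ.^ (m % n) ℕ.*_) (≡.trans (≡.cong (q ℕ.^_) (ℕ.*-comm (m / n) n)) (≡.sym (ℕ.^-*-assoc q n (m / n)))))) ⟩
    x ^ (q ℕ.^ (m % n) ℕ.* (q ℕ.^ n) ℕ.^ (m / n))
      ≈⟨ ^-assocʳ x (q ℕ.^ (m % n)) _ ⟨
    (x ^ (q ℕ.^ (m % n))) ^ ((q ℕ.^ n) ℕ.^ (m / n))
      ≈⟨ x^N^k≈x (m / n) _ ⟩
    x ^ (q ℕ.^ (m % n)) ∎)

  frobenius-cong : ∀ i {x y} → x ≈ y → frobenius i x ≈ frobenius i y
  frobenius-cong i = ^-congˡ (q ℕ.^ (i %ℕ n))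

  frobenius-≋ : ∀ {i j} → i ≋ j → ∀ x → frobenius i x ≈ frobenius j x
  frobenius-≋ i≋j x = ^-congʳ x (≡.cong (q ℕ.^_) (%ℕ-cong i≋j))

  frobenius-+ : ∀ i j x → frobenius (i ℤ.+ j) x ≈ frobenius i (frobenius j x)
  frobenius-+ i j x = begin
    frobenius (i ℤ.+ j) x
      ≈⟨ frobenius-≋ (≋-sym (≋-trans (≋-+ (%ℕ-≋ j) (%ℕ-≋ i)) (≋-reflexive (ℤ.+-comm j i)))) x ⟩
    frobenius (+ (j %ℕ n ℕ.+ i %ℕ n)) x
      ≈⟨ frobenius-+ℕ (j %ℕ n ℕ.+ i %ℕ n) x ⟩
    x ^ (q ℕ.^ (j %ℕ n ℕ.+ i %ℕ n))
      ≈⟨ ^-congʳ x (ℕ.^-distribˡ-+-* q (j %ℕ n) (i %ℕ n)) ⟩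
    x ^ (q ℕ.^ (j %ℕ n) ℕ.* q ℕ.^ (i %ℕ n))
      ≈⟨ ^-assocʳ x (q ℕ.^ (j %ℕ n)) (q ℕ.^ (i %ℕ n)) ⟨
    frobenius i (frobenius j x) ∎

  frobenius-0 : ∀ x → frobenius (+ 0) x ≈ x
  frobenius-0 x = trans (frobenius-+ℕ 0 x) (*-identityʳ x)

  frobenius-* : ∀ i x y → frobenius i (x * y) ≈ frobenius i x * frobenius i y
  frobenius-* i x y = ^-distrib-* x y (q ℕ.^ (i %ℕ n))

  frobenius-injective : ∀ i {x} → frobenius i x ≈ 0# → x ≈ 0#
  frobenius-injective i {x} xⁱ≈0 = decidable-stable (x ≟ 0#) λ x≉0 → x^m≉0 x≉0 (q ℕ.^ (i %ℕ n)) xⁱ≈0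

  -- Indexing by all integers, with period n, turns the rotation in `^[ j ]` into subtraction of `j`
  -- from the index.
  coefficient : 𝓛 → ℤ → Carrier
  coefficient f i = f (residue i)

  coefficient-≋ : ∀ f {i j} → i ≋ j → coefficient f i ≈ coefficient f j
  coefficient-≋ f i≋j = reflexive (≡.cong f (residue-cong i≋j))

  coefficient-^[] : ∀ f j i → coefficient (f ^[ j ]) i ≈ frobenius j (coefficient f (i ℤ.- j))
  coefficient-^[] f j i = frobenius-cong j (coefficient-≋ f (≋-+ (toℕ-residue i) (≋-reflexive ≡.refl)))

  ^[]-cong : ∀ j {f g} → f ≈ᴹ g → f ^[ j ] ≈ᴹ g ^[ j ]
  ^[]-cong j f≈g m = frobenius-cong j (f≈g _)

  ^[]-≋ : ∀ f {i j} → i ≋ j → f ^[ i ] ≈ᴹ f ^[ j ]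
  ^[]-≋ f {i} {j} i≋j m = trans (frobenius-≋ i≋j _)
    (frobenius-cong j (coefficient-≋ f (≋-+ {+ toℕ m} (≋-reflexive ≡.refl) (≋-neg i≋j))))

  ^[]-+ : ∀ f i j → f ^[ i ] ^[ j ] ≈ᴹ f ^[ i ℤ.+ j ]
  ^[]-+ f i j m = begin
    frobenius j (coefficient (f ^[ i ]) (+ toℕ m ℤ.- j))
      ≈⟨ frobenius-cong j (coefficient-^[] f i (+ toℕ m ℤ.- j)) ⟩
    frobenius j (frobenius i (coefficient f (+ toℕ m ℤ.- j ℤ.- i)))
      ≈⟨ frobenius-+ j i _ ⟨
    frobenius (j ℤ.+ i) (coefficient f (+ toℕ m ℤ.- j ℤ.- i))
      ≈⟨ frobenius-≋ (≋-reflexive (ℤ.+-comm j i)) _ ⟩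
    frobenius (i ℤ.+ j) (coefficient f (+ toℕ m ℤ.- j ℤ.- i))
      ≈⟨ frobenius-cong (i ℤ.+ j) (coefficient-≋ f (≋-reflexive (lemma (+ toℕ m) i j))) ⟩
    frobenius (i ℤ.+ j) (coefficient f (+ toℕ m ℤ.- (i ℤ.+ j))) ∎
    where
    lemma : ∀ m i j → m ℤ.- j ℤ.- i ≡ m ℤ.- (i ℤ.+ j)
    lemma = solve-∀

  ^[0] : ∀ f → f ^[ + 0 ] ≈ᴹ f
  ^[0] f m = trans (frobenius-0 _)
    (trans (coefficient-≋ f (≋-reflexive (ℤ.+-identityʳ (+ toℕ m)))) (reflexive (≡.cong f (residue-toℕ m))))

  ^[]-homo-+ : ∀ j f g → (f +ᴹ g) ^[ j ] ≈ᴹ f ^[ j ] +ᴹ g ^[ j ]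
  ^[]-homo-+ j f g m = ^q^-distrib-+ (j %ℕ n) _ _

  ^[]-homo-* : ∀ j a f → (a *ₗ f) ^[ j ] ≈ᴹ frobenius j a *ₗ f ^[ j ]
  ^[]-homo-* j a f m = frobenius-* j a _

  -- The summand depends only on the residue of its index, and adding `k` permutes the residues.
  sum-rotate : (T : ℤ → Carrier) → (∀ {i j} → i ≋ j → T i ≈ T j) → ∀ k →
    sum {n} (λ i → T (+ toℕ i ℤ.+ k)) ≈ sum {n} (λ i → T (+ toℕ i))
  sum-rotate T T-≋ k = trans
    (sum-cong-≋ {n} (λ i → T-≋ (≋-sym (toℕ-residue (+ toℕ i ℤ.+ k)))))
    (sym (sum-permute (λ i → T (+ toℕ i)) (rotation k)))

  -- The field trace from `F` to `𝔽q`, as the sum of all conjugates.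
  trace : Carrier → Carrier
  trace x = sum {n} (λ i → frobenius (+ toℕ i) x)

  -- Raising to the power q is additive and moves every conjugate to the next one, so it merely
  -- rotates the sum.
  trace∈𝔽q : ∀ x → trace x ∈ 𝔽q
  trace∈𝔽q x = begin
    trace x ^ q                                       ≈⟨ ^-congʳ (trace x) (ℕ.^-identityʳ q) ⟨
    trace x ^ (q ℕ.^ 1)                               ≈⟨ ^q^-sum {n} 1 _ ⟩
    sum {n} (λ i → frobenius (+ toℕ i) x ^ (q ℕ.^ 1)) ≈⟨ sum-cong-≋ {n} step ⟩
    sum {n} (λ i → frobenius (+ toℕ i ℤ.+ + 1) x)     ≈⟨ sum-rotate (λ i → frobenius i x) (λ i≋j → frobenius-≋ i≋j x) (+ 1) ⟩
    trace x                                           ∎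
    where
    step : ∀ (i : Fin n) → frobenius (+ toℕ i) x ^ (q ℕ.^ 1) ≈ frobenius (+ toℕ i ℤ.+ + 1) x
    step i = begin
      frobenius (+ toℕ i) x ^ (q ℕ.^ 1)           ≈⟨ frobenius-+ℕ 1 _ ⟨
      frobenius (+ 1) (frobenius (+ toℕ i) x)     ≈⟨ frobenius-+ (+ 1) (+ toℕ i) x ⟨
      frobenius (+ 1 ℤ.+ + toℕ i) x               ≈⟨ frobenius-≋ (≋-reflexive (ℤ.+-comm (+ 1) (+ toℕ i))) x ⟩
      frobenius (+ toℕ i ℤ.+ + 1) x               ∎

  𝔽q-frobenius : ∀ {a} → a ∈ 𝔽q → ∀ m → a ^ (q ℕ.^ m) ≈ a
  𝔽q-frobenius {a} a∈ zero    = *-identityʳ a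
  𝔽q-frobenius {a} a∈ (suc m) =
    trans (sym (^-assocʳ a q (q ℕ.^ m))) (trans (^-congˡ (q ℕ.^ m) a∈) (𝔽q-frobenius a∈ m))

  trace-* : ∀ {a} → a ∈ 𝔽q → ∀ x → trace (a * x) ≈ a * trace x
  trace-* {a} a∈ x = trans
    (sum-cong-≋ {n} (λ i → trans (frobenius-* (+ toℕ i) a x) (*-congʳ (𝔽q-frobenius a∈ (+ toℕ i %ℕ n)))))
    (sym (*-distribˡ-sum {n} a _))

  trace-cong : ∀ {x y} → x ≈ y → trace x ≈ trace y
  trace-cong x≈y = sum-cong-≋ {n} (λ i → frobenius-cong (+ toℕ i) x≈y)

  -- The linearized polynomial of the map sending x to `trace (b * x)`.
  tracePolynomial : Carrier → 𝓛
  tracePolynomial b i = frobenius (+ toℕ i) b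

  eval-tracePolynomial : ∀ b x → eval (tracePolynomial b) x ≈ trace (b * x)
  eval-tracePolynomial b x = sum-cong-≋ {n} λ i → begin
    frobenius (+ toℕ i) b * x ^ (q ℕ.^ toℕ i)     ≈⟨ *-congˡ (frobenius-+ℕ (toℕ i) x) ⟨
    frobenius (+ toℕ i) b * frobenius (+ toℕ i) x ≈⟨ frobenius-* (+ toℕ i) b x ⟨
    frobenius (+ toℕ i) (b * x)                   ∎

  -- All values are traces, hence lie in `𝔽q`. Either they all vanish and the rank is zero, or one
  -- nonzero value `t` spans the image: the quotient of any value by `t` is again in `𝔽q`, and
  -- multiples of `t` are attained at multiples of `x₁`.
  tracePolynomial∈𝓤₁ : ∀ b → tracePolynomial b ∈ 𝓤₁
  tracePolynomial∈𝓤₁ b with any? (λ {x} {y} x≈y tr≉0 tr≈0 → tr≉0 (trans (trace-cong (*-congˡ x≈y)) tr≈0))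
                                (λ x → ¬? (trace (b * x) ≟ 0#))
  ... | no none = 0 , z≤n , (λ ()) , (λ _ _ _ ()) ,
        (λ (x , y≈) → (λ ()) , (λ ()) , trans y≈ (trans (eval-tracePolynomial b x) (tr≈0 x))) ,
        λ (_ , _ , y≈0) → 0# , trans y≈0 (sym (trans (eval-tracePolynomial b 0#) (tr≈0 0#)))
    where
    tr≈0 : ∀ x → trace (b * x) ≈ 0#
    tr≈0 x = decidable-stable (trace (b * x) ≟ 0#) λ ≉0 → none (x , ≉0)
  ... | yes (x₁ , t≉0) = 1 , s≤s z≤n , (λ _ → t) ,
        (λ { a _ at≈0 zero → x*y≈0⇒y≈0 t≉0 (trans (*-comm t (a zero)) (trans (sym (+-identityʳ _)) at≈0)) }) ,
        (λ {y} (x , y≈) → (λ _ → trace (b * x) * t⁻¹) , (λ _ → quotient∈𝔽q x) , (begin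
          y                              ≈⟨ trans y≈ (eval-tracePolynomial b x) ⟩
          trace (b * x)                  ≈⟨ *-identityʳ _ ⟨
          trace (b * x) * 1#             ≈⟨ *-congˡ t⁻¹t≈1 ⟨
          trace (b * x) * (t⁻¹ * t)      ≈⟨ *-assoc _ _ _ ⟨
          trace (b * x) * t⁻¹ * t        ≈⟨ +-identityʳ _ ⟨
          trace (b * x) * t⁻¹ * t + 0#   ∎)) ,
        λ {y} (a , a∈ , y≈) → a zero * x₁ , (begin
          y                              ≈⟨ y≈ ⟩
          a zero * t + 0#                ≈⟨ +-identityʳ _ ⟩
          a zero * t                     ≈⟨ trace-* (a∈ zero) (b * x₁) ⟨
          trace (a zero * (b * x₁))      ≈⟨ trace-cong (trans (sym (*-assoc _ _ _)) (trans (*-congʳ (*-comm _ _)) (*-assoc _ _ _))) ⟩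
          trace (b * (a zero * x₁))      ≈⟨ eval-tracePolynomial b (a zero * x₁) ⟨
          eval (tracePolynomial b) (a zero * x₁) ∎)
    where
    t = trace (b * x₁)
    t⁻¹ = proj₁ (inverse t≉0)
    t⁻¹t≈1 = proj₂ (inverse t≉0)

    t⁻¹∈𝔽q : t⁻¹ ∈ 𝔽q
    t⁻¹∈𝔽q = *-cancelˡ t≉0 (begin
      t * t⁻¹ ^ q        ≈⟨ *-congʳ (trace∈𝔽q (b * x₁)) ⟨
      t ^ q * t⁻¹ ^ q    ≈⟨ ^-distrib-* t t⁻¹ q ⟨
      (t * t⁻¹) ^ q      ≈⟨ ^-congˡ q (trans (*-comm t t⁻¹) t⁻¹t≈1) ⟩
      1# ^ q             ≈⟨ 1^m≈1 q ⟩
      1#                 ≈⟨ trans (*-comm t t⁻¹) t⁻¹t≈1 ⟨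
      t * t⁻¹            ∎)

    quotient∈𝔽q : ∀ x → trace (b * x) * t⁻¹ ∈ 𝔽q
    quotient∈𝔽q x = trans (^-distrib-* _ t⁻¹ q) (*-cong (trace∈𝔽q (b * x)) t⁻¹∈𝔽q)

  -- The exponents `q ^ i` and `q ^ j` differ and are smaller than the order of the field, so
  -- `powers-differ` separates the two maps.
  frobenius-distinct : ∀ (i j : Fin n) → i ≢ j → ∃[ x ] ¬ frobenius (+ toℕ i) x ≈ frobenius (+ toℕ j) x
  frobenius-distinct i j i≢j with ℕ.<-cmp (toℕ i) (toℕ j)
  ... | tri≈ _ i≡j _ = contradiction (Fin.toℕ-injective i≡j) i≢j
  ... | tri< i<j _ _ = let x , xⁱ≉xʲ = powers-differ (q^-mono i<j) (q^-mono (Fin.toℕ<n j)) in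
        x , λ eq → xⁱ≉xʲ (trans (sym (frobenius-+ℕ (toℕ i) x)) (trans eq (frobenius-+ℕ (toℕ j) x)))
    where q^-mono = ℕ.^-monoʳ-< q 1<q
  ... | tri> _ _ j<i = let x , xʲ≉xⁱ = powers-differ (q^-mono j<i) (q^-mono (Fin.toℕ<n i)) in
        x , λ eq → xʲ≉xⁱ (trans (sym (frobenius-+ℕ (toℕ j) x)) (trans (sym eq) (frobenius-+ℕ (toℕ i) x)))
    where q^-mono = ℕ.^-monoʳ-< q 1<q

  combination-coefficient : ∀ (a : Vector Carrier d) (v : Vector 𝓛 d) m →
    combination a v m ≈ sum (λ i → a i * v i m)
  combination-coefficient {zero}  a v m = refl
  combination-coefficient {suc d} a v m = +-congˡ (combination-coefficient (tail a) (tail v) m)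

  -- This sum of conjugates is invariant under the Frobenius group, which
  -- forces it to be a trace polynomial.
  conjugates-combination : ∀ f x →
    combination {n} (λ i → frobenius (+ toℕ i) x) (λ i → f ^[ + toℕ i ]) ≈ᴹ
    tracePolynomial (sum {n} (λ i → frobenius (+ toℕ i) (coefficient f (ℤ.- (+ toℕ i))) * frobenius (+ toℕ i) x))
  conjugates-combination f x m = begin
    combination {n} (λ i → frobenius (+ toℕ i) x) (λ i → f ^[ + toℕ i ]) m
      ≈⟨ combination-coefficient {n} _ _ m ⟩
    sum {n} (λ i → T (+ toℕ i))
      ≈⟨ sum-rotate T T-≋ (+ toℕ m) ⟨
    sum {n} (λ i → T (+ toℕ i ℤ.+ + toℕ m))
      ≈⟨ sum-cong-≋ {n} (λ i → T-shift (+ toℕ i)) ⟩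
    sum {n} (λ i → frobenius (+ toℕ m) (t i))
      ≈⟨ ^q^-sum {n} (+ toℕ m %ℕ n) t ⟨
    frobenius (+ toℕ m) (sum t) ∎
    where
    t : Fin n → Carrier
    t i = frobenius (+ toℕ i) (coefficient f (ℤ.- (+ toℕ i))) * frobenius (+ toℕ i) x

    T : ℤ → Carrier
    T k = frobenius k x * frobenius k (coefficient f (+ toℕ m ℤ.- k))

    T-≋ : ∀ {i j} → i ≋ j → T i ≈ T j
    T-≋ {i} {j} i≋j = *-cong (frobenius-≋ i≋j x) (^[]-≋ f i≋j m)

    T-shift : ∀ i → T (i ℤ.+ + toℕ m) ≈ frobenius (+ toℕ m) (frobenius i (coefficient f (ℤ.- i)) * frobenius i x)
    T-shift i = begin
      frobenius (i ℤ.+ M) x * frobenius (i ℤ.+ M) (coefficient f (M ℤ.- (i ℤ.+ M)))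
        ≈⟨ *-comm _ _ ⟩
      frobenius (i ℤ.+ M) (coefficient f (M ℤ.- (i ℤ.+ M))) * frobenius (i ℤ.+ M) x
        ≈⟨ *-cong (trans (frobenius-cong (i ℤ.+ M) (coefficient-≋ f (≋-reflexive (lemma M i)))) (split _)) (split x) ⟩
      frobenius M (frobenius i (coefficient f (ℤ.- i))) * frobenius M (frobenius i x)
        ≈⟨ frobenius-* M _ _ ⟨
      frobenius M (frobenius i (coefficient f (ℤ.- i)) * frobenius i x) ∎
      where
      M = + toℕ m
      lemma : ∀ M i → M ℤ.- (i ℤ.+ M) ≡ ℤ.- i
      lemma = solve-∀
      split : ∀ y → frobenius (i ℤ.+ M) y ≈ frobenius M (frobenius i y)
      split y = trans (frobenius-≋ (≋-reflexive (ℤ.+-comm i M)) y) (frobenius-+ M i y)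

  module _ {C : Pred 𝓛 w} (C-sub : IsSubspace C) (no-rank-one : ∀ {f} → f ∈ C → f ∈ 𝓤₁ → f ≈ᴹ 0ᴹ) where

    -- For every `x`, a combination of the conjugates of `f` is the trace polynomial of the sum of
    -- `h i * frobenius i x`. It lies in `C` and has rank at most one, so it vanishes and with it
    -- that sum. Independence of the Frobenius powers gives `h ≈ 0`, and each `h i` is a conjugate
    -- of a coefficient of `f`.
    conjugates∈C⇒≈0 : ∀ {f} → (∀ i → f ^[ i ] ∈ C) → f ≈ᴹ 0ᴹ
    conjugates∈C⇒≈0 {f} f∈C m = begin
      f m                                      ≈⟨ reflexive (≡.cong f (residue-toℕ m)) ⟨
      coefficient f (+ toℕ m)                  ≈⟨ coefficient-≋ f -k≋m ⟨
      coefficient f (ℤ.- (+ toℕ k))            ≈⟨ frobenius-injective (+ toℕ k) (h≈0 k) ⟩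
      0#                                       ∎
      where
      -- `h k` involves the coefficient at `- k`, so coefficient `m` is read off at the residue of
      -- `- m`.
      k = residue (ℤ.- (+ toℕ m))

      -k≋m : ℤ.- (+ toℕ k) ≋ + toℕ m
      -k≋m = ≋-trans (≋-neg (toℕ-residue (ℤ.- (+ toℕ m)))) (≋-reflexive (ℤ.neg-involutive (+ toℕ m)))

      h : Vector Carrier n
      h i = frobenius (+ toℕ i) (coefficient f (ℤ.- (+ toℕ i)))

      Σ≈0 : ∀ x → sum (λ i → h i * frobenius (+ toℕ i) x) ≈ 0#
      -- Coefficient `m` of the vanishing trace polynomial is a conjugate of the sum in question;
      -- any other coefficient would serve equally.
      Σ≈0 x = frobenius-injective (+ toℕ m)
        (no-rank-one (IsSubspace.resp-≈ᴹ C-sub (conjugates-combination f x)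
          (combination-∈ {d = n} C-sub (λ i → frobenius (+ toℕ i) x) (λ i → f∈C (+ toℕ i)))) (tracePolynomial∈𝓤₁ _) m)

      h≈0 : ∀ i → h i ≈ 0#
      h≈0 = characters-independent (λ i → frobenius (+ toℕ i)) (λ i → 1^m≈1 (q ℕ.^ (+ toℕ i %ℕ n)))
        (λ i → frobenius-* (+ toℕ i)) frobenius-distinct h Σ≈0

-- The theorem, with σ the map sending f to f^[s]

open import Data.Nat.Base using (_+_; _∸_; _^_; _≤_; _<_)

module _
  {c ℓ₁ ℓ₂} (F : HeytingField c ℓ₁ ℓ₂) (q : ℕ) (q-primePower : IsPrimePower q)
  (n : ℕ) .{{_ : NonZero n}} (finite : HasOrder F (q ^ n)) (s : ℤ) (s-coprime : gcd s (+ n) ≡ + 1)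
  where

  open LinearizedPolynomials F q n
  open LeftModule 𝓛-leftModule using (≈ᴹ-refl; ≈ᴹ-sym; ≈ᴹ-trans; 0ᴹ)
  open FrobeniusAction F q q-primePower n finite
  open Congruence n
  open FiniteFieldLinearAlgebra F finite 𝓛-leftModule _≟ᴹ_
  open Chains F finite 𝓛-leftModule _≟ᴹ_

  ^[]-semilinear : ∀ j → IsSemilinear (frobenius j) (_^[ j ])
  ^[]-semilinear j = record
    { cong   = ^[]-cong j
    ; homo-+ = ^[]-homo-+ j
    ; homo-* = ^[]-homo-* j
    }

  ^[]-inverse : ∀ i j → i ℤ.+ j ≡ + 0 → ∀ f → f ^[ i ] ^[ j ] ≈ᴹ f
  ^[]-inverse i j i+j≡0 f =
    ≈ᴹ-trans (^[]-+ f i j) (≈ᴹ-trans (^[]-≋ f (≋-reflexive i+j≡0)) (^[0] f))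

  open SemilinearAutomorphism (frobenius s) (frobenius (ℤ.- s)) (frobenius-injective (ℤ.- s))
    (_^[ s ]) (_^[ ℤ.- s ]) (^[]-semilinear s) (^[]-semilinear (ℤ.- s))
    (^[]-inverse (ℤ.- s) s (ℤ.+-inverseˡ s)) (^[]-inverse s (ℤ.- s) (ℤ.+-inverseʳ s))

  iterate-^[] : ∀ j t f → iterate (_^[ j ]) t f ≈ᴹ f ^[ j ℤ.* + t ]
  iterate-^[] j zero    f = ≈ᴹ-sym (≈ᴹ-trans (^[]-≋ f (≋-reflexive (ℤ.*-zeroʳ j))) (^[0] f))
  iterate-^[] j (suc t) f = ≈ᴹ-trans (iterate-^[] j t (f ^[ j ]))
    (≈ᴹ-trans (^[]-+ f j (j ℤ.* + t)) (^[]-≋ f (≋-reflexive (≡.sym (ℤ.*-suc j (+ t))))))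

  chain≈orbit : ∀ f d i → chain f d i ≈ᴹ orbit s f d i
  chain≈orbit f d i = iterate-^[] s (toℕ i) f

  ++-≈ᴹ : {xs xs′ : Vector 𝓛 d} {ys ys′ : Vector 𝓛 e} →
    (∀ i → xs i ≈ᴹ xs′ i) → (∀ j → ys j ≈ᴹ ys′ j) → ∀ k → (xs ++ ys) k ≈ᴹ (xs′ ++ ys′) k
  ++-≈ᴹ {d = d} xs≈ ys≈ k with splitAt d k
  ... | inj₁ i = xs≈ i
  ... | inj₂ j = ys≈ j

  -- With `shift⊆^⟦⟧` this identifies the image `W ^⟦ s ⟧` of the statement with the preimage under
  -- the inverse map that defines `shift`.
  ^⟦⟧⊆shift : {W : Pred 𝓛 w} → IsSubspace W → W ^⟦ s ⟧ ⊆ shift W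
  ^⟦⟧⊆shift W-sub (f , f∈W , g≈f^s) = IsSubspace.resp-≈ᴹ W-sub
    (≈ᴹ-sym (≈ᴹ-trans (^[]-cong (ℤ.- s) g≈f^s) (^[]-inverse s (ℤ.- s) (ℤ.+-inverseʳ s) f))) f∈W

  shift⊆^⟦⟧ : {W : Pred 𝓛 w} → shift W ⊆ W ^⟦ s ⟧
  shift⊆^⟦⟧ {x = g} τg∈W = g ^[ ℤ.- s ] , τg∈W , ≈ᴹ-sym (^[]-inverse (ℤ.- s) s (ℤ.+-inverseˡ s) g)

  module _ {C : Pred 𝓛 w} (C-sub : IsSubspace C) (C∩𝓤₁≐0 : (C ∩ 𝓤₁) ≐ zeroSubspace) where

    private
      V = C ∩ (C ^⟦ s ⟧)

    V≐core : V ≐ core C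
    V≐core = (λ (∈C , ∈Cˢ) → ∈C , ^⟦⟧⊆shift C-sub ∈Cˢ) ,
             (λ (∈C , τ∈C) → ∈C , shift⊆^⟦⟧ {W = C} τ∈C)

    V∩V^s≐core² : (V ∩ (V ^⟦ s ⟧)) ≐ core (core C)
    V∩V^s≐core² =
      (λ (∈V , g , g∈V , f≈) → proj₁ V≐core ∈V ,
        ^⟦⟧⊆shift (core-isSubspace C-sub) (g , proj₁ V≐core g∈V , f≈)) ,
      λ (∈core , τ∈core) → proj₂ V≐core ∈core ,
        (let g , g∈core , f≈ = shift⊆^⟦⟧ {W = core C} τ∈core in g , proj₂ V≐core g∈core , f≈)

    -- Because `s` is invertible modulo n, the iterates of `^[ - s ]` run through all conjugates of
    -- `f`.
    no-orbit : ∀ {f} → (∀ t → iterate (_^[ ℤ.- s ]) t f ∈ C) → f ≈ᴹ 0ᴹ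
    no-orbit {f} τᵗf∈C = conjugates∈C⇒≈0 C-sub (λ f∈C f∈𝓤₁ → proj₁ C∩𝓤₁≐0 (f∈C , f∈𝓤₁)) λ i →
      -- As `u * s` is congruent to 1, the product `- s * - (u * i)` is congruent to `i`. Reduction
      -- modulo n turns the integer `- (u * i)` into an iteration count.
      let t = (ℤ.- (u ℤ.* i)) %ℕ n in
      IsSubspace.resp-≈ᴹ C-sub
        (≈ᴹ-trans (iterate-^[] (ℤ.- s) t f) (^[]-≋ f (-s*t≋ i))) (τᵗf∈C t)
      where
      u = proj₁ (gcd≡1⇒invertible s s-coprime)

      -s*t≋ : ∀ i → ℤ.- s ℤ.* + ((ℤ.- (u ℤ.* i)) %ℕ n) ≋ i
      -s*t≋ i = ≋-trans (≋-*ˡ (ℤ.- s) (%ℕ-≋ (ℤ.- (u ℤ.* i))))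
        (≋-trans (≋-reflexive (lemma s u i))
          (≋-trans (≋-*ˡ i (proj₂ (gcd≡1⇒invertible s s-coprime))) (≋-reflexive (ℤ.*-identityʳ i))))
        where
        lemma : ∀ s u i → ℤ.- s ℤ.* ℤ.- (u ℤ.* i) ≡ i ℤ.* (u ℤ.* s)
        lemma = solve-∀

    -- The drop from `core C` is one, so `core C` is a single chain of k - 2 vectors. Started one
    -- step earlier it has k - 1, and `Q` supplies the last dimension.
    orbit-and-vector : ∀ {k d₁ d₂} → HasDimension C k → HasDimension V d₁ → d₁ + 2 ≡ k →
      HasDimension (V ∩ (V ^⟦ s ⟧)) d₂ → d₂ + 3 ≡ k →
      ∃[ P ] ∃[ Q ] (P ∈ C × Q ∈ C × C ≐ ⟨ orbit s P (k ∸ 1) ⟩ ⊕ ⟨ Q ∷ [] ⟩)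
    orbit-and-vector {k} {d₁} {d₂} C-dim V-dim d₁+2≡k V₂-dim d₂+3≡k =
      go (≡.trans (≡.sym d₂+3≡k) (ℕ.+-comm d₂ 3))
         (ℕ.+-cancelʳ-≡ 2 d₁ (suc d₂) (≡.trans d₁+2≡k (≡.trans (≡.sym d₂+3≡k) (ℕ.+-suc d₂ 2))))
         C-dim (dimension-≐ V-dim V≐core) (dimension-≐ V₂-dim V∩V^s≐core²)
      where
      -- `k` and `d₁` become variables, so that the dimension equations, rewritten in terms of `d₂`,
      -- can be matched with `refl`.
      go : ∀ {k d₁} → k ≡ 3 + d₂ → d₁ ≡ suc d₂ → HasDimension C k → HasDimension (core C) d₁ →
        HasDimension (core (core C)) d₂ →
        ∃[ P ] ∃[ Q ] (P ∈ C × Q ∈ C × C ≐ ⟨ orbit s P (k ∸ 1) ⟩ ⊕ ⟨ Q ∷ [] ⟩)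
      go ≡.refl ≡.refl C-dim V-dim V₂-dim =
        let x , V-span = one-chain no-orbit d₂ V-dim proj₁ V₂-dim
            P = x ^[ ℤ.- s ]
            Q , C-span = chain-and-vector no-orbit C-dim id ≡.refl V-dim V-span
        in P , Q , proj₁ C-span zero ,
           span-least C-sub (proj₁ C-span) (∈-span-++ʳ (chain P (2 + d₂)) (chain Q 1) zero) ,
           spanning⇒⊕ (≡.subst (HasDimension C) (ℕ.+-comm 1 (2 + d₂)) C-dim)
             (spannedBy-resp C-sub
               (++-≈ᴹ {xs = chain P (2 + d₂)} {orbit s P (2 + d₂)} {chain Q 1} {Q ∷ []}
                 (chain≈orbit P (2 + d₂)) (λ { zero → ≈ᴹ-refl }))
               C-span)

    -- The first two drops are both two, so `core C` consists of two nonempty chains. Lengthening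
    -- each by one gives `C`, and this is where the lower bound 2 on both lengths comes from.
    two-orbits : ∀ {k d₁ d₂} → HasDimension C k → HasDimension V d₁ → d₁ + 2 ≡ k →
      HasDimension (V ∩ (V ^⟦ s ⟧)) d₂ → d₂ + 4 ≡ k →
      ∃[ P ] ∃[ Q ] (P ∈ C × Q ∈ C × ∃[ i ] ∃[ j ] (2 ≤ i × 2 ≤ j × i + j ≡ k ×
        C ≐ ⟨ orbit s P i ⟩ ⊕ ⟨ orbit s Q j ⟩))
    two-orbits {k} {d₁} {d₂} C-dim V-dim d₁+2≡k V₂-dim d₂+4≡k =
      go (≡.trans (≡.sym d₂+4≡k) (ℕ.+-comm d₂ 4))
         (ℕ.+-cancelʳ-≡ 2 d₁ (2 + d₂) (≡.trans d₁+2≡k (≡.trans (≡.sym d₂+4≡k)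
           (≡.trans (ℕ.+-suc d₂ 3) (≡.cong suc (ℕ.+-suc d₂ 2))))))
         C-dim (dimension-≐ V-dim V≐core) (dimension-≐ V₂-dim V∩V^s≐core²)
      where
      go : ∀ {k d₁} → k ≡ 4 + d₂ → d₁ ≡ 2 + d₂ → HasDimension C k → HasDimension (core C) d₁ →
        HasDimension (core (core C)) d₂ →
        ∃[ P ] ∃[ Q ] (P ∈ C × Q ∈ C × ∃[ i ] ∃[ j ] (2 ≤ i × 2 ≤ j × i + j ≡ k ×
          C ≐ ⟨ orbit s P i ⟩ ⊕ ⟨ orbit s Q j ⟩))
      go ≡.refl ≡.refl C-dim V-dim V₂-dim =
        let x , y , i , j , i+j≡ , V-span = two-chains no-orbit d₂ V-dim proj₁ V₂-dim
            P = x ^[ ℤ.- s ]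
            Q = y ^[ ℤ.- s ]
            xs = chain P (2 + i)
            ys = chain Q (2 + j)
            C-span = two-chains-extend no-orbit C-dim id V-dim V₂-dim ℕ.≤-refl V-span
            i+j≡k = ≡.cong (λ m → 2 + m) (≡.trans (ℕ.+-suc i (suc j)) i+j≡)
        in P , Q , proj₁ C-span zero , span-least C-sub (proj₁ C-span) (∈-span-++ʳ xs ys zero) ,
           2 + i , 2 + j , s≤s (s≤s z≤n) , s≤s (s≤s z≤n) , i+j≡k ,
           spanning⇒⊕ (≡.subst (HasDimension C) (≡.sym i+j≡k) C-dim)
             (spannedBy-resp C-sub
               (++-≈ᴹ {xs = xs} {orbit s P (2 + i)} {ys} {orbit s Q (2 + j)}
                 (chain≈orbit P (2 + i)) (chain≈orbit Q (2 + j)))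
               C-span)

theorem3p6 : ∀ {c ℓ₁ ℓ₂ ℓ} (q : ℕ) → IsPrimePower q →
    (n : ℕ) .{{_ : NonZero n}} (s : ℤ) → gcd s (+ n) ≡ + 1 →
    (F : HeytingField c ℓ₁ ℓ₂) → HasOrder F (q ^ n) →
    let open LinearizedPolynomials F q n in
    (k : ℕ) → 2 < k →
    (C : Pred 𝓛 ℓ) → IsSubspace C → HasDimension C k →
    let V = C ∩ (C ^⟦ s ⟧) in
    (∃[ d ] (HasDimension V d × d + 2 ≡ k)) →
    (C ∩ 𝓤₁) ≐ zeroSubspace →
    ((∃[ d ] (HasDimension (V ∩ (V ^⟦ s ⟧)) d × d + 3 ≡ k)) →
    ∃[ P ] ∃[ Q ] (P ∈ C × Q ∈ C ×
    C ≐ ⟨ orbit s P (k ∸ 1) ⟩ ⊕ ⟨ Q ∷ [] ⟩))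
    ×
    ((∃[ d ] (HasDimension (V ∩ (V ^⟦ s ⟧)) d × d + 4 ≡ k)) →
    ∃[ P ] ∃[ Q ] (P ∈ C × Q ∈ C ×
    ∃[ i ] ∃[ j ] (2 ≤ i × 2 ≤ j × i + j ≡ k ×
    C ≐ ⟨ orbit s P i ⟩ ⊕ ⟨ orbit s Q j ⟩)))
theorem3p6 q q-primePower n s s-coprime F finite k _ C C-sub C-dim (d₁ , V-dim , d₁+2≡k) C∩𝓤₁≐0 =
  (λ (d₂ , V₂-dim , d₂+3≡k) →
    orbit-and-vector F q q-primePower n finite s s-coprime C-sub C∩𝓤₁≐0 C-dim V-dim d₁+2≡k V₂-dim d₂+3≡k) ,
  (λ (d₂ , V₂-dim , d₂+4≡k) →
    two-orbits F q q-primePower n finite s s-coprime C-sub C∩𝓤₁≐0 C-dim V-dim d₁+2≡k V₂-dim d₂+4≡k)
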